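{- Let $q$ be an even power of an odd prime with $\sqrt{q} \equiv -1 \pmod 4$. In $\mathrm{PG}(2,q)$ let $\mathcal{C}$ be the conic $X_2^2 - X_1X_3 = 0$ and let $\perp$ be the orthogonal polarity defined by $\mathcal{C}$, which maps the point $P=(x_1,x_2,x_3)$ to the line $P^\perp: x_3X_1 - 2x_2X_2 + x_1X_3 = 0$. Let $G$ be the group of collineations induced by the matrices $$\begin{pmatrix} a^2 & 2ac & c^2 \\ ab & ad+bc & cd \\ b^2 & 2bd & d^2 \end{pmatrix},\qquad a,b,c,d \in \mathbb{F}_{\sqrt{q}},\ ad-bc\neq 0.$$ Then there are $(\sqrt{q}+1)/2$ distinct $G$-orbits consisting of internal points of $\mathcal{C}$ such that, for every point $P$ in such an orbit, no point of the orbit $P^G$ lies on the line $P^\perp$.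
   Context: A point not on $\mathcal{C}$ is internal if it lies on no tangent line of $\mathcal{C}$; equivalently, $(x_1,x_2,x_3)\notin\mathcal{C}$ is internal iff $x_2^2-x_1x_3$ is a non-square in $\mathbb{F}_q$. Points are column vectors and matrices act on the left. -}

module Defs where

open import Data.Nat using (ℕ; suc; _≤_; _%_; _^_)
open import Data.Nat.Primality using (Prime)
open import Data.Fin using (Fin)
open import Data.Bool using (Bool; true)
open import Data.List using (List; length; filterᵇ; allFin)
open import Data.List.Relation.Unary.All using (All)
open import Data.List.Relation.Unary.Any using (Any)
open import Data.List.Relation.Unary.AllPairs using (AllPairs)
open import Data.Product using (Σ; ∃; _×_; _,_)
open import Relation.Nullary using (¬_)
open import Relation.Binary.PropositionalEquality using (_≡_; _≢_)
open import Algebra.Structures using (IsCommutativeRing)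

record FiniteField (q : ℕ) : Set where
  infixl 6 _+_ _-_
  infixl 7 _*_
  field
    _+_ _*_ : Fin q → Fin q → Fin q
    -_      : Fin q → Fin q
    0# 1#   : Fin q
    isCommutativeRing : IsCommutativeRing _≡_ _+_ _*_ -_ 0# 1#
    0≢1     : 0# ≢ 1#
    inverse : ∀ x → x ≢ 0# → ∃ λ y → x * y ≡ 1#

  infix 8 -_
  _-_ : Fin q → Fin q → Fin q
  x - y = x + (- y)

  2# : Fin q
  2# = 1# + 1#

record Subfield {q : ℕ} (F : FiniteField q) (r : ℕ) : Set where
  open FiniteField F
  field
    member   : Fin q → Bool
    has-0    : member 0# ≡ true
    has-1    : member 1# ≡ true
    closed-+ : ∀ x y → member x ≡ true → member y ≡ true → member (x + y) ≡ true
    closed-* : ∀ x y → member x ≡ true → member y ≡ true → member (x * y) ≡ true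
    closed-- : ∀ x → member x ≡ true → member (- x) ≡ true
    closed-⁻¹ : ∀ x y → member x ≡ true → x * y ≡ 1# → member y ≡ true
    size     : length (filterᵇ member (allFin q)) ≡ r

module Plane {q : ℕ} (F : FiniteField q) where
  open FiniteField F

  -- Homogeneous coordinates (x₁, x₂, x₃); a point of PG(2,q) is a nonzero
  -- vector up to nonzero scalars.
  Vec3 : Set
  Vec3 = Fin q × Fin q × Fin q

  NonZero3 : Vec3 → Set
  NonZero3 v = ¬ (v ≡ (0# , 0# , 0#))

  scale : Fin q → Vec3 → Vec3
  scale t (x₁ , x₂ , x₃) = (t * x₁ , t * x₂ , t * x₃)

  _∼_ : Vec3 → Vec3 → Set
  u ∼ v = Σ (Fin q) λ t → t ≢ 0# × u ≡ scale t v

  Qform : Vec3 → Fin q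
  Qform (x₁ , x₂ , x₃) = x₂ * x₂ - x₁ * x₃

  IsSquare : Fin q → Set
  IsSquare z = ∃ λ y → y * y ≡ z

  Internal : Vec3 → Set
  Internal v = Qform v ≢ 0# × ¬ IsSquare (Qform v)

  OnPerp : Vec3 → Vec3 → Set
  OnPerp (x₁ , x₂ , x₃) (y₁ , y₂ , y₃) = x₃ * y₁ - 2# * x₂ * y₂ + x₁ * y₃ ≡ 0#

  actG : Fin q → Fin q → Fin q → Fin q → Vec3 → Vec3
  actG a b c d (x₁ , x₂ , x₃) =
    ( a * a * x₁ + 2# * a * c * x₂ + c * c * x₃
    , a * b * x₁ + (a * d + b * c) * x₂ + c * d * x₃
    , b * b * x₁ + 2# * b * d * x₂ + d * d * x₃ )

  module WithSubfield {r : ℕ} (K : Subfield F r) where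
    open Subfield K

    InOrbit : Vec3 → Vec3 → Set
    InOrbit P Q = Σ (Fin q) λ a → Σ (Fin q) λ b → Σ (Fin q) λ c → Σ (Fin q) λ d →
      member a ≡ true × member b ≡ true × member c ≡ true × member d ≡ true ×
      (a * d - b * c ≢ 0#) × Q ∼ actG a b c d P

    GoodOrbit : Vec3 → Set
    GoodOrbit P = (∀ X → InOrbit P X → Internal X) ×
                  (∀ X Y → InOrbit P X → InOrbit P Y → ¬ OnPerp X Y)

    NumGoodOrbits≡ : ℕ → Set
    NumGoodOrbits≡ n = Σ (List Vec3) λ reps →
      length reps ≡ n ×
      All (λ P → NonZero3 P × GoodOrbit P) reps ×
      AllPairs (λ P P′ → ¬ InOrbit P P′) reps ×
      (∀ P → NonZero3 P → GoodOrbit P → Any (λ R → InOrbit R P) reps)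

{-# OPTIONS --safe #-}
-- Write r = √q = |K|. An internal point lies on a unique K-rational line, which is secant or
-- external to the conic over K. Call X, Y conjugate if Y ∈ X^⊥. On an external line a quarter
-- turn in G sends each point to a conjugate one, so no such orbit qualifies. A point on a
-- secant line is equivalent to some (1, 0, s) with s a nonsquare of F, and conjugacy to one of
-- its images would be an equation (cs + b)² = (2bc - a² - d²)s with a, b, c, d ∈ K; every
-- element of K is a square in F, so s would be one too. Hence the orbits in question are those
-- of the points (1, 0, s). Those of s and t agree iff t = k²s or t = k²/s with k ∈ K*; such a
-- class has r - 1 elements, and the (r² - 1)/2 nonsquares form (r + 1)/2 classes.
module Submission where

open import Defs
open import Algebra.Bundles using (CommutativeRing)
open import Data.Bool using (true)
open import Data.Bool.Properties using (T-≡; T?) renaming (_≟_ to _≟ᵇ_)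
open import Data.Empty using (⊥; ⊥-elim)
open import Data.Fin using (Fin)
open import Data.Fin.Properties using (_≟_; any?)
open import Data.Integer as ℤ using (ℤ; +_; -[1+_]; _⊖_; _◃_)
open import Data.Integer.Properties as ℤ using ([1+m]⊖[1+n]≡m⊖n; +◃n≡+n; -◃n≡-n)
open import Data.List using (List; []; _∷_; length; map; filter; filterᵇ; allFin; cartesianProduct)
open import Data.List.Properties using (filter-notAll; length-map; length-tabulate; length-++)
open import Data.List.Membership.Propositional using (_∈_; _∉_)
open import Data.List.Membership.Propositional.Properties using (∈-filter⁺; ∈-filter⁻; ∈-allFin; ∈-map⁺; ∈-map⁻; ∈-cartesianProduct⁻)
open import Data.List.Relation.Unary.Any as Any using (Any; here; there)
import Data.List.Relation.Unary.Any.Properties as Any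
open import Data.List.Relation.Unary.All as All using (All; []; _∷_)
import Data.List.Relation.Unary.All.Properties as All
open import Data.List.Relation.Unary.AllPairs as AllPairs using (AllPairs; []; _∷_)
import Data.List.Relation.Unary.AllPairs.Properties as AllPairs
open import Data.List.Relation.Unary.Unique.Propositional using (Unique)
open import Data.List.Relation.Unary.Unique.Propositional.Properties using (filter⁺; allFin⁺; cartesianProduct⁺)
import Data.Maybe as Maybe
open import Data.Nat as ℕ using (ℕ; zero; suc; _≤_; z≤n; s≤s)
open import Data.Nat.DivMod using (m≡m%n+[m/n]*n; m*n/n≡m)
open import Data.Nat.Primality using (Prime)
import Data.Nat.Properties as ℕ
open import Data.Nat.Tactic.RingSolver using (solve-∀)
open import Data.Product using (∃; _×_; _,_; proj₁; proj₂)
import Data.Sign as Sign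
open import Data.Sum using (_⊎_; inj₁; inj₂; [_,_]′)
open import Function using (_∘_; Equivalence)
open import Level using (0ℓ)
open import Relation.Nullary using (¬_; Dec; yes; no; contradiction; ¬?)
open import Relation.Nullary.Decidable using (_×-dec_; decidable-stable; dec⇒maybe)
open import Relation.Unary using (Pred; Decidable)
open import Relation.Binary.Definitions using (DecidableEquality; WeaklyDecidable)
open import Relation.Binary.PropositionalEquality as ≡ using (_≡_; _≢_; refl; sym; trans; cong; cong₂; subst; subst₂; module ≡-Reasoning)
open import Algebra.Solver.Ring.AlmostCommutativeRing using (_-Raw-AlmostCommutative⟶_; Induced-equivalence; fromCommutativeRing)

-- The congruence r ≡ 3 mod 4 decides which lines fail. On a K-rational line that is not tangent,
-- choose coordinates u, v in which the conic restricts to uv = 0. The point of the line conjugate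
-- to (u, v) is (u, -v), so a collineation that fixes both conic points and sends (u, v) there comes
-- from a two-by-two matrix whose eigenvalue ratio is a square root of -1: an element of order 4.
-- The collineations of G fixing both conic points form a cyclic group, of order r + 1 for an
-- external line and r - 1 for a secant one, and 4 divides only the first. The same congruence makes
-- the order of K* equal to 2 mod 4, so -1 is a nonsquare of K and every nonzero element of K is
-- plus or minus a square of K. This dichotomy is the working tool: it separates secant from
-- external lines, turns all of K into squares of F once -1 is one, and lets K* index a class of
-- points (1, 0, s). It is proved by counting, with no appeal to a generator of K*.

map-unique : ∀ {A B : Set} {f : A → B} {xs} →
  (∀ {x y} → x ∈ xs → y ∈ xs → f x ≡ f y → x ≡ y) → Unique xs → Unique (map f xs)
map-unique inj []        = []
map-unique {A} {B} {f} inj (x∉ ∷ u) = head (λ y∈ → inj (here refl) (there y∈)) x∉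
                         ∷ map-unique (λ p q → inj (there p) (there q)) u
  where
  head : ∀ {x ys} → (∀ {y} → y ∈ ys → f x ≡ f y → x ≡ y) → All (x ≢_) ys → All (f x ≢_) (map f ys)
  head i []        = []
  head i (x≢ ∷ ps) = x≢ ∘ i (here refl) ∷ head (i ∘ there) ps

length-filter-∁ : ∀ {A : Set} {P : Pred A 0ℓ} (P? : Decidable P) xs →
  length (filter P? xs) ℕ.+ length (filter (¬? ∘ P?) xs) ≡ length xs
length-filter-∁ P? [] = refl
length-filter-∁ P? (x ∷ xs) with P? x
... | yes _ = cong suc (length-filter-∁ P? xs)
... | no  _ = trans (ℕ.+-suc _ _) (cong suc (length-filter-∁ P? xs))

-- Counting with duplicate-free lists and equal-sized classes.

module Counting {A : Set} (_≟_ : DecidableEquality A) where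

  -- Pigeonhole, by deleting the head of `xs` from `ys`: the deletion shortens `ys` and loses no
  -- later element of `xs`.
  length-mono : ∀ {xs ys : List A} → Unique xs → (∀ {x} → x ∈ xs → x ∈ ys) →
    length xs ≤ length ys
  length-mono [] _ = z≤n
  length-mono {x ∷ xs} {ys} (x∉xs ∷ u) xs⊆ys = ℕ.≤-trans
    (s≤s (length-mono u λ y∈xs → ∈-filter⁺ ≢x? (xs⊆ys (there y∈xs)) (λ { refl → All.lookup x∉xs y∈xs refl })))
    (filter-notAll ≢x? ys (Any.map (λ { refl x≢x → x≢x refl }) (xs⊆ys (here refl))))
    where
    ≢x? : Decidable (_≢ x)
    ≢x? y = ¬? (y ≟ x)

  length-cong : ∀ {xs ys : List A} → Unique xs → Unique ys →
    (∀ {x} → x ∈ xs → x ∈ ys) → (∀ {x} → x ∈ ys → x ∈ xs) → length xs ≡ length ys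
  length-cong u v s t = ℕ.≤-antisym (length-mono u s) (length-mono v t)

  _∈?_ : ∀ x (xs : List A) → Dec (x ∈ xs)
  x ∈? xs = Any.any? (x ≟_) xs

  infix 5 _∖_
  _∖_ : List A → A → List A
  xs ∖ x = filter (λ y → ¬? (y ≟ x)) xs

  length-∖ : ∀ {x xs} → Unique xs → x ∈ xs → suc (length (xs ∖ x)) ≡ length xs
  length-∖ {x} {xs} u x∈ = length-cong
    (All.tabulate (λ y∈ x≡y → proj₂ (∈-filter⁻ _ {xs = xs} y∈) (sym x≡y)) ∷ filter⁺ _ u) u
    (λ { (here refl) → x∈ ; (there y∈) → proj₁ (∈-filter⁻ _ y∈) })
    λ {y} y∈ → case (y ≟ x) y∈
    where
    case : ∀ {y} → Dec (y ≡ x) → y ∈ xs → y ∈ x ∷ (xs ∖ x)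
    case (yes refl) _ = here refl
    case (no y≢x) y∈ = there (∈-filter⁺ _ y∈ y≢x)

  -- An equivalence relation given by listing its classes, so that their size can be counted. The
  -- laws are asked only on members of `xs`, since the classes of interest behave well only at
  -- nonsquares.
  record Partitioned (cls : A → List A) (m : ℕ) (xs : List A) : Set where
    field
      unique     : Unique xs
      cls-unique : ∀ {x} → x ∈ xs → Unique (cls x)
      cls-length : ∀ {x} → x ∈ xs → length (cls x) ≡ m
      cls-⊆      : ∀ {x y} → x ∈ xs → y ∈ cls x → y ∈ xs
      cls-refl   : ∀ {x} → x ∈ xs → x ∈ cls x
      cls-sym    : ∀ {x y} → x ∈ xs → y ∈ cls x → x ∈ cls y
      cls-trans  : ∀ {x y z} → x ∈ xs → y ∈ cls x → z ∈ cls y → z ∈ cls x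

  record Transversal (cls : A → List A) (m : ℕ) (xs : List A) : Set where
    field
      reps     : List A
      size     : length reps ℕ.* m ≡ length xs
      reps-⊆   : All (_∈ xs) reps
      separate : AllPairs (λ x y → y ∉ cls x) reps
      cover    : ∀ {y} → y ∈ xs → Any (λ x → y ∈ cls x) reps

  -- Greedy choice: keep the head, delete its whole class, and repeat. What remains is again a union
  -- of classes, by symmetry and transitivity. The bound `n` on the length drives the recursion,
  -- because the filtered list is not a structural sublist.
  transversal : ∀ {cls m xs} → Partitioned cls m xs → Transversal cls m xs
  transversal {cls} {m} p = go _ p ℕ.≤-refl
    where
    go : ∀ n {xs} → Partitioned cls m xs → length xs ≤ n → Transversal cls m xs
    go n {[]} p _ = record
      { reps = [] ; size = refl ; reps-⊆ = [] ; separate = [] ; cover = λ () }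
    go (suc n) {x ∷ xs} p (s≤s ≤n) = record
      { reps     = x ∷ T.reps
      ; size     = trans (cong₂ ℕ._+_ (sym ∣class∣) T.size) (length-filter-∁ in-cls? (x ∷ xs))
      ; reps-⊆   = here refl ∷ All.map (λ y∈ → proj₁ (rest⁻ y∈)) T.reps-⊆
      ; separate = All.map (λ y∈ → proj₂ (rest⁻ y∈)) T.reps-⊆ ∷ T.separate
      ; cover    = λ {y} y∈ → cover (y ∈? cls x) y∈
      }
      where
      open Partitioned p
      in-cls? : Decidable (_∈ cls x)
      in-cls? y = y ∈? cls x
      x∈ : x ∈ x ∷ xs
      x∈ = here refl
      rest : List A
      rest = filter (¬? ∘ in-cls?) (x ∷ xs)
      rest⁻ : ∀ {y} → y ∈ rest → y ∈ x ∷ xs × y ∉ cls x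
      rest⁻ = ∈-filter⁻ (¬? ∘ in-cls?)
      ∣class∣ : length (filter in-cls? (x ∷ xs)) ≡ m
      ∣class∣ = trans (length-cong (filter⁺ in-cls? unique) (cls-unique x∈)
        (λ y∈ → proj₂ (∈-filter⁻ in-cls? {xs = x ∷ xs} y∈)) (λ y∈ → ∈-filter⁺ in-cls? (cls-⊆ x∈ y∈) y∈)) (cls-length x∈)
      partitioned : Partitioned cls m rest
      partitioned = record
        { unique     = filter⁺ (¬? ∘ in-cls?) unique
        ; cls-unique = cls-unique ∘ proj₁ ∘ rest⁻
        ; cls-length = cls-length ∘ proj₁ ∘ rest⁻
        ; cls-⊆      = λ y∈ z∈y → let (y∈xs , y∉x) = rest⁻ y∈ in
            ∈-filter⁺ (¬? ∘ in-cls?) (cls-⊆ y∈xs z∈y) (λ z∈x → y∉x (cls-trans x∈ z∈x (cls-sym y∈xs z∈y)))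
        ; cls-refl   = cls-refl ∘ proj₁ ∘ rest⁻
        ; cls-sym    = cls-sym ∘ proj₁ ∘ rest⁻
        ; cls-trans  = cls-trans ∘ proj₁ ∘ rest⁻
        }
      shorter : length rest ≤ n
      shorter = ℕ.≤-trans (ℕ.s≤s⁻¹ (filter-notAll (¬? ∘ in-cls?) (x ∷ xs) (here λ x∉ → x∉ (cls-refl x∈)))) ≤n
      module T = Transversal (go n partitioned shorter)
      cover : ∀ {y} → Dec (y ∈ cls x) → y ∈ x ∷ xs → Any (λ z → y ∈ cls z) (x ∷ T.reps)
      cover (yes y∈x) _  = here y∈x
      cover (no y∉x)  y∈ = there (T.cover (∈-filter⁺ (¬? ∘ in-cls?) y∈ y∉x))

  involution : ∀ {f : A → A} {xs} → Unique xs →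
    (∀ {x} → x ∈ xs → f x ∈ xs) → (∀ {x} → x ∈ xs → f (f x) ≡ x) →
    (∀ {x} → x ∈ xs → f x ≢ x) →
    Partitioned (λ x → x ∷ f x ∷ []) 2 xs
  involution {f} u f∈ ff fx≢x = record
    { unique     = u
    ; cls-unique = λ x∈ → (fx≢x x∈ ∘ sym ∷ []) ∷ [] ∷ []
    ; cls-length = λ _ → refl
    ; cls-⊆      = λ { x∈ (here refl) → x∈ ; x∈ (there (here refl)) → f∈ x∈ }
    ; cls-refl   = λ _ → here refl
    ; cls-sym    = λ { x∈ (here refl) → here refl ; x∈ (there (here refl)) → there (here (sym (ff x∈))) }
    ; cls-trans  = λ { x∈ (here refl) z∈ → z∈
                     ; x∈ (there (here refl)) (here refl) → there (here refl)
                     ; x∈ (there (here refl)) (there (here refl)) → here (ff x∈) }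
    }

  -- The classes are the orbits of the four-group generated by two commuting involutions. All have
  -- size 4 because none of the three nontrivial elements has a fixed point.
  klein : ∀ {f g : A → A} {xs} → Unique xs →
    (∀ {x} → x ∈ xs → f x ∈ xs) → (∀ {x} → x ∈ xs → g x ∈ xs) →
    (∀ {x} → x ∈ xs → f (f x) ≡ x) → (∀ {x} → x ∈ xs → g (g x) ≡ x) →
    (∀ {x} → x ∈ xs → f (g x) ≡ g (f x)) →
    (∀ {x} → x ∈ xs → f x ≢ x) → (∀ {x} → x ∈ xs → g x ≢ x) → (∀ {x} → x ∈ xs → g (f x) ≢ x) →
    Partitioned (λ x → x ∷ f x ∷ g x ∷ g (f x) ∷ []) 4 xs
  klein {f} {g} {xs} u f∈ g∈ ff gg fg fx≢ gx≢ gfx≢ = record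
    { unique     = u
    ; cls-unique = λ x∈ →
        (fx≢ x∈ ∘ sym ∷ gx≢ x∈ ∘ sym ∷ gfx≢ x∈ ∘ sym ∷ [])
        ∷ ((λ e → gfx≢ x∈ (trans (cong g e) (gg x∈))) ∷ gx≢ (f∈ x∈) ∘ sym ∷ [])
        ∷ ((λ e → fx≢ (g∈ x∈) (trans (fg x∈) (sym e))) ∷ []) ∷ [] ∷ []
    ; cls-length = λ _ → refl
    ; cls-⊆      = λ { x∈ (here refl) → x∈ ; x∈ (there (here refl)) → f∈ x∈
                     ; x∈ (there (there (here refl))) → g∈ x∈ ; x∈ (there (there (there (here refl)))) → g∈ (f∈ x∈) }
    ; cls-refl   = λ _ → here refl
    ; cls-sym    = λ { x∈ (here refl) → here refl
                     ; x∈ (there (here refl)) → there (here (sym (ff x∈)))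
                     ; x∈ (there (there (here refl))) → there (there (here (sym (gg x∈))))
                     ; x∈ (there (there (there (here refl)))) → there (there (there (here (sym (gfgf x∈))))) }
    ; cls-trans  = λ { x∈ (here refl) z∈ → z∈
                     ; x∈ (there (here refl)) (here refl) → there (here refl)
                     ; x∈ (there (here refl)) (there (here refl)) → here (ff x∈)
                     ; x∈ (there (here refl)) (there (there (here refl))) → there (there (there (here refl)))
                     ; x∈ (there (here refl)) (there (there (there (here refl)))) → there (there (here (cong g (ff x∈))))
                     ; x∈ (there (there (here refl))) (here refl) → there (there (here refl))
                     ; x∈ (there (there (here refl))) (there (here refl)) → there (there (there (here (fg x∈))))
                     ; x∈ (there (there (here refl))) (there (there (here refl))) → here (gg x∈)
                     ; x∈ (there (there (here refl))) (there (there (there (here refl)))) →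
                         there (here (trans (cong g (fg x∈)) (gg (f∈ x∈))))
                     ; x∈ (there (there (there (here refl)))) (here refl) → there (there (there (here refl)))
                     ; x∈ (there (there (there (here refl)))) (there (here refl)) →
                         there (there (here (trans (fg (f∈ x∈)) (cong g (ff x∈)))))
                     ; x∈ (there (there (there (here refl)))) (there (there (here refl))) → there (here (gg (f∈ x∈)))
                     ; x∈ (there (there (there (here refl)))) (there (there (there (here refl)))) → here (gfgf x∈) }
    }
    where
    gfgf : ∀ {x} → x ∈ xs → g (f (g (f x))) ≡ x
    gfgf x∈ = trans (cong g (fg (f∈ x∈))) (trans (gg (f∈ (f∈ x∈))) (ff x∈))

-- A ring solver with integer coefficients.

module IntegerCoefficients {c ℓ} (R : CommutativeRing c ℓ) where

  open CommutativeRing R hiding (zero) renaming (refl to ≈-refl; sym to ≈-sym; trans to ≈-trans)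
  open import Algebra.Properties.Ring ring using (-0#≈0#; -‿distribˡ-*; -‿distribʳ-*; -‿+-comm; -‿involutive)
  open import Algebra.Properties.Semiring.Mult.TCOptimised semiring using (1+×; ×-homo-+; ×1-homo-*) renaming (_×_ to _·_)
  open import Relation.Binary.Reasoning.Setoid setoid

  -- With this form of the multiple `_·_`, the numerals 0, 1 and 2 unfold to `0#`, `1#` and
  -- `1# + 1#`, so `con (+ 2)` agrees definitionally with `2#` in the field identities below.
  fromℤ : ℤ → Carrier
  fromℤ (+ n)      = n · 1#
  fromℤ -[1+ n ] = - (suc n · 1#)

  fromℤ-neg : ∀ n → fromℤ (ℤ.- (+ n)) ≈ - (n · 1#)
  fromℤ-neg zero    = ≈-sym -0#≈0#
  fromℤ-neg (suc n) = ≈-refl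

  fromℤ-- : ∀ i → fromℤ (ℤ.- i) ≈ - fromℤ i
  fromℤ-- (+ n)    = fromℤ-neg n
  fromℤ-- -[1+ n ] = ≈-sym (-‿involutive _)

  fromℤ-⊖ : ∀ m n → fromℤ (m ⊖ n) ≈ m · 1# + - (n · 1#)
  fromℤ-⊖ zero    zero    = ≈-sym (≈-trans (+-congˡ -0#≈0#) (+-identityʳ _))
  fromℤ-⊖ zero    (suc n) = ≈-sym (+-identityˡ _)
  fromℤ-⊖ (suc m) zero    = ≈-sym (≈-trans (+-congˡ -0#≈0#) (+-identityʳ _))
  fromℤ-⊖ (suc m) (suc n) = begin
    fromℤ (suc m ⊖ suc n)                        ≡⟨ ≡.cong fromℤ ([1+m]⊖[1+n]≡m⊖n m n) ⟩
    fromℤ (m ⊖ n)                                ≈⟨ fromℤ-⊖ m n ⟩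
    m · 1# + - (n · 1#)                      ≈⟨ +-congʳ (+-identityˡ _) ⟨
    0# + m · 1# + - (n · 1#)                 ≈⟨ +-congʳ (+-congʳ (-‿inverseʳ 1#)) ⟨
    1# + - 1# + m · 1# + - (n · 1#)          ≈⟨ +-congʳ (+-assoc _ _ _) ⟩
    1# + (- 1# + m · 1#) + - (n · 1#)        ≈⟨ +-congʳ (+-congˡ (+-comm _ _)) ⟩
    1# + (m · 1# + - 1#) + - (n · 1#)        ≈⟨ +-congʳ (+-assoc _ _ _) ⟨
    1# + m · 1# + - 1# + - (n · 1#)          ≈⟨ +-assoc _ _ _ ⟩
    1# + m · 1# + (- 1# + - (n · 1#))        ≈⟨ +-congˡ (-‿+-comm 1# (n · 1#)) ⟩
    1# + m · 1# + - (1# + n · 1#)            ≈⟨ +-cong (1+× m 1#) (-‿cong (1+× n 1#)) ⟨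
    suc m · 1# + - (suc n · 1#)              ∎

  fromℤ-+ : ∀ i j → fromℤ (i ℤ.+ j) ≈ fromℤ i + fromℤ j
  fromℤ-+ (+ m)    (+ n)    = ×-homo-+ 1# m n
  fromℤ-+ (+ m)    -[1+ n ] = fromℤ-⊖ m (suc n)
  fromℤ-+ -[1+ m ] (+ n)    = ≈-trans (fromℤ-⊖ n (suc m)) (+-comm _ _)
  fromℤ-+ -[1+ m ] -[1+ n ] = begin
    - (suc (suc (m ℕ.+ n)) · 1#)       ≡⟨ ≡.cong (λ k → - (suc k · 1#)) (ℕ.+-suc m n) ⟨
    - ((suc m ℕ.+ suc n) · 1#)         ≈⟨ -‿cong (×-homo-+ 1# (suc m) (suc n)) ⟩
    - (suc m · 1# + suc n · 1#)        ≈⟨ -‿+-comm _ _ ⟨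
    - (suc m · 1#) + - (suc n · 1#)    ∎

  fromℤ-* : ∀ i j → fromℤ (i ℤ.* j) ≈ fromℤ i * fromℤ j
  fromℤ-* (+ m)    (+ n)    = ≈-trans (reflexive (≡.cong fromℤ (+◃n≡+n (m ℕ.* n)))) (×1-homo-* m n)
  fromℤ-* (+ m)    -[1+ n ] = begin
    fromℤ (Sign.- ◃ (m ℕ.* suc n))         ≡⟨ ≡.cong fromℤ (-◃n≡-n (m ℕ.* suc n)) ⟩
    fromℤ (ℤ.- (+ (m ℕ.* suc n)))          ≈⟨ fromℤ-neg (m ℕ.* suc n) ⟩
    - ((m ℕ.* suc n) · 1#)             ≈⟨ -‿cong (×1-homo-* m (suc n)) ⟩
    - (m · 1# * (suc n · 1#))          ≈⟨ -‿distribʳ-* _ _ ⟩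
    m · 1# * - (suc n · 1#)            ∎
  fromℤ-* -[1+ m ] (+ n)    = begin
    fromℤ (Sign.- ◃ (suc m ℕ.* n))         ≡⟨ ≡.cong fromℤ (-◃n≡-n (suc m ℕ.* n)) ⟩
    fromℤ (ℤ.- (+ (suc m ℕ.* n)))          ≈⟨ fromℤ-neg (suc m ℕ.* n) ⟩
    - ((suc m ℕ.* n) · 1#)             ≈⟨ -‿cong (×1-homo-* (suc m) n) ⟩
    - (suc m · 1# * (n · 1#))          ≈⟨ -‿distribˡ-* _ _ ⟩
    - (suc m · 1#) * (n · 1#)          ∎
  fromℤ-* -[1+ m ] -[1+ n ] = begin
    (suc m ℕ.* suc n) · 1#             ≈⟨ ×1-homo-* (suc m) (suc n) ⟩
    suc m · 1# * (suc n · 1#)          ≈⟨ -‿involutive _ ⟨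
    - - (suc m · 1# * (suc n · 1#))    ≈⟨ -‿cong (-‿distribˡ-* _ _) ⟩
    - (- (suc m · 1#) * (suc n · 1#))  ≈⟨ -‿distribʳ-* _ _ ⟩
    - (suc m · 1#) * - (suc n · 1#)    ∎

  morphism : ℤ.+-*-rawRing -Raw-AlmostCommutative⟶ fromCommutativeRing R
  morphism = record
    { ⟦_⟧ = fromℤ ; +-homo = fromℤ-+ ; *-homo = fromℤ-* ; -‿homo = fromℤ-- ; 0-homo = ≈-refl ; 1-homo = ≈-refl }

  -- Equality of integers suffices for equality of their images. Coincidences caused by the
  -- characteristic go undetected, which costs completeness but not soundness.
  _coeff≟_ : WeaklyDecidable (Induced-equivalence morphism)
  i coeff≟ j = Maybe.map (λ i≡j → reflexive (≡.cong fromℤ i≡j)) (dec⇒maybe (i ℤ.≟ j))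

  open import Algebra.Solver.Ring ℤ.+-*-rawRing (fromCommutativeRing R) morphism _coeff≟_ public
    using (solve; _:=_; _:+_; _:*_; _:-_; :-_; con)

length-cartesianProduct : ∀ {A B : Set} (xs : List A) (ys : List B) →
  length (cartesianProduct xs ys) ≡ length xs ℕ.* length ys
length-cartesianProduct []       ys = refl
length-cartesianProduct (x ∷ xs) ys =
  trans (length-++ (map (x ,_) ys)) (cong₂ ℕ._+_ (length-map _ ys) (length-cartesianProduct xs ys))

-- Finite fields: inverses, squares and the number of nonsquares.

module FieldProperties {q : ℕ} (F : FiniteField q) where
  open FiniteField F

  commutativeRing : CommutativeRing _ _
  commutativeRing = record { isCommutativeRing = isCommutativeRing }

  open CommutativeRing commutativeRing public
    using (-‿inverseʳ; *-identityˡ; zeroˡ; zeroʳ; *-comm; *-assoc; ring)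
  open import Algebra.Properties.Ring ring public using (-‿involutive) renaming (x∙y⁻¹≈ε⇒x≈y to x-y≡0⇒x≡y)
  open IntegerCoefficients commutativeRing public
  open Counting (_≟_ {q}) public
  open Plane F public using (IsSquare)

  -- An equation follows from hypotheses once the difference of its sides is a linear
  -- combination of the differences of theirs, and that is a ring identity.
  by₁ : ∀ {u v x y} c → x ≡ y → u - v ≡ c * (x - y) → u ≡ v
  by₁ {u} {v} {x} c refl e = x-y≡0⇒x≡y u v (trans e (trans (cong (c *_) (-‿inverseʳ x)) (zeroʳ c)))

  by₂ : ∀ {u v x y x′ y′} c c′ → x ≡ y → x′ ≡ y′ →
    u - v ≡ c * (x - y) + c′ * (x′ - y′) → u ≡ v
  by₂ {x = x} {x′ = x′} c c′ refl refl e = by₁ 0# (refl {x = x}) (trans e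
    (solve 4 (λ c c′ x x′ → c :* (x :- x) :+ c′ :* (x′ :- x′) := con (+ 0) :* (x :- x)) refl c c′ x x′))

  infix 9 _⁻¹
  -- Made total by the value 0 at 0, so that an inverse can enter a polynomial identity as one more
  -- variable, with x * x ⁻¹ ≡ 1 as a hypothesis.
  _⁻¹ : Fin q → Fin q
  x ⁻¹ with x ≟ 0#
  ... | yes _  = 0#
  ... | no x≢0 = proj₁ (inverse x x≢0)

  ⁻¹-inverseʳ : ∀ {x} → x ≢ 0# → x * x ⁻¹ ≡ 1#
  ⁻¹-inverseʳ {x} x≢0 with x ≟ 0#
  ... | yes x≡0 = contradiction x≡0 x≢0
  ... | no  x≢0 = proj₂ (inverse x x≢0)

  1≢0 : 1# ≢ 0#
  1≢0 = 0≢1 ∘ sym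

  integral : ∀ {x y} → x * y ≡ 0# → x ≢ 0# → y ≡ 0#
  integral {x} {y} xy≡0 x≢0 = by₂ (x ⁻¹) (- y) xy≡0 (⁻¹-inverseʳ x≢0)
    (solve 3 (λ x y i → y :- con (+ 0) := i :* (x :* y :- con (+ 0)) :+ :- y :* (x :* i :- con (+ 1))) refl x y (x ⁻¹))

  *≢0 : ∀ {x y} → x ≢ 0# → y ≢ 0# → x * y ≢ 0#
  *≢0 x≢0 y≢0 xy≡0 = y≢0 (integral xy≡0 x≢0)

  *≢0ˡ : ∀ {x y} → x * y ≢ 0# → x ≢ 0#
  *≢0ˡ {y = y} xy≢0 refl = xy≢0 (zeroˡ y)

  square≡0 : ∀ {x} → x * x ≡ 0# → x ≡ 0#
  square≡0 {x} xx≡0 with x ≟ 0#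
  ... | yes x≡0 = x≡0
  ... | no  x≢0 = integral xx≡0 x≢0

  ⁻¹≢0 : ∀ {x} → x ≢ 0# → x ⁻¹ ≢ 0#
  ⁻¹≢0 {x} x≢0 e = 1≢0 (trans (sym (⁻¹-inverseʳ x≢0)) (trans (cong (x *_) e) (zeroʳ x)))

  -≢0 : ∀ {x} → x ≢ 0# → - x ≢ 0#
  -≢0 {x} x≢0 e = x≢0 (by₁ (- 1#) e (solve 1 (λ x → x :- con (+ 0) := :- con (+ 1) :* (:- x :- con (+ 0))) refl x))

  ⁻¹-unique : ∀ {x y} → x * y ≡ 1# → x ⁻¹ ≡ y
  ⁻¹-unique {x} {y} xy≡1 = by₂ y (- x ⁻¹) (⁻¹-inverseʳ x≢0) xy≡1
    (solve 3 (λ x y i → i :- y := y :* (x :* i :- con (+ 1)) :+ :- i :* (x :* y :- con (+ 1))) refl x y (x ⁻¹))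
    where
    x≢0 : x ≢ 0#
    x≢0 = *≢0ˡ (1≢0 ∘ trans (sym xy≡1))

  *-cancelʳ : ∀ {x y z} → z ≢ 0# → x * z ≡ y * z → x ≡ y
  *-cancelʳ {x} {y} {z} z≢0 e = by₂ (z ⁻¹) (- (x - y)) e (⁻¹-inverseʳ z≢0)
    (solve 4 (λ x y z i → x :- y := i :* (x :* z :- y :* z) :+ :- (x :- y) :* (z :* i :- con (+ 1))) refl x y z (z ⁻¹))

  isSquare? : Decidable IsSquare
  isSquare? z = any? λ y → y * y ≟ z

  square-injective : ∀ {x y} → x * x ≡ y * y → y ≡ x ⊎ y ≡ - x
  square-injective {x} {y} e with y - x ≟ 0#
  ... | yes d = inj₁ (x-y≡0⇒x≡y y x d)
  ... | no  d = inj₂ (by₁ 1# (integral {y - x} {y + x} (by₁ (- 1#) e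
      (solve 2 (λ x y → (y :- x) :* (y :+ x) :- con (+ 0) := :- con (+ 1) :* (x :* x :- y :* y)) refl x y)) d)
      (solve 2 (λ x y → y :- :- x := con (+ 1) :* (y :+ x :- con (+ 0))) refl x y))

  -x≢x : 2# ≢ 0# → ∀ {x} → x ≢ 0# → - x ≢ x
  -x≢x 2≢0 {x} x≢0 e = x≢0 (integral {2#} (by₁ (- 1#) e
    (solve 1 (λ x → con (+ 2) :* x :- con (+ 0) := :- con (+ 1) :* (:- x :- x)) refl x)) 2≢0)

  elements : List (Fin q)
  elements = allFin q

  ∣elements∣ : length elements ≡ q
  ∣elements∣ = length-tabulate _

  -- A missed element could be put in front of `xs`, giving a duplicate-free list longer than the
  -- field.
  complete : ∀ {xs} → Unique xs → q ≤ length xs → ∀ x → x ∈ xs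
  complete {xs} u q≤ x with x ∈? xs
  ... | yes x∈ = x∈
  ... | no  x∉ = contradiction
    (ℕ.≤-trans (length-mono {x ∷ xs} (All.tabulate (λ { y∈ refl → x∉ y∈ }) ∷ u) (λ _ → ∈-allFin _)) (ℕ.≤-reflexive ∣elements∣))
    (ℕ.<⇒≱ (s≤s q≤))

  -- If 2 were 0, then x ↦ x + 1 would be a fixed-point-free involution of the field, and q would be
  -- even.
  odd⇒2≢0 : ∀ m → q ≡ suc (2 ℕ.* m) → 2# ≢ 0#
  odd⇒2≢0 m q-odd 2≡0 = ℕ.even≢odd (length reps) m
    (trans (ℕ.*-comm 2 (length reps)) (trans size (trans ∣elements∣ q-odd)))
    where
    open Transversal (transversal (involution {_+ 1#} {elements} (allFin⁺ q) (λ _ → ∈-allFin _)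
      (λ {x} _ → by₁ 1# 2≡0 (solve 1 (λ x → x :+ con (+ 1) :+ con (+ 1) :- x := con (+ 1) :* (con (+ 2) :- con (+ 0))) refl x))
      (λ {x} _ e → 1≢0 (by₁ 1# e (solve 1 (λ x → con (+ 1) :- con (+ 0) := con (+ 1) :* (x :+ con (+ 1) :- x)) refl x)))))

  -- For a finite set of nonzero elements closed under negation, squaring is two-to-one.
  module Squares (2≢0 : 2# ≢ 0#) {xs : List (Fin q)} (unique : Unique xs)
    (nonzero : ∀ {x} → x ∈ xs → x ≢ 0#) (neg : ∀ {x} → x ∈ xs → - x ∈ xs) where

    open Transversal (transversal (involution { -_} {xs} unique neg
      (λ {x} _ → -‿involutive x) (-x≢x 2≢0 ∘ nonzero))) public

    squares : List (Fin q)
    squares = map (λ x → x * x) reps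

    squares-unique : Unique squares
    squares-unique = AllPairs.map⁺ (AllPairs.map
      (λ y∉ e → y∉ ([ (λ { refl → here refl }) , (λ { refl → there (here refl) }) ]′ (square-injective e))) separate)

    ∈-squares⁺ : ∀ {x} → x ∈ xs → x * x ∈ squares
    ∈-squares⁺ {x} x∈ = aux (cover x∈)
      where
      aux : ∀ {ys} → Any (λ y → x ∈ y ∷ - y ∷ []) ys → x * x ∈ map (λ y → y * y) ys
      aux (here (here refl)) = here refl
      aux {y ∷ _} (here (there (here refl))) = here (solve 1 (λ y → :- y :* :- y := y :* y) refl y)
      aux (there a) = there (aux a)

    ∈-squares⁻ : ∀ {y} → y ∈ squares → ∃ λ x → x ∈ xs × y ≡ x * x
    ∈-squares⁻ y∈ = let (x , x∈ , e) = ∈-map⁻ _ y∈ in x , All.lookup reps-⊆ x∈ , e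

    ∣squares∣ : length squares ℕ.* 2 ≡ length xs
    ∣squares∣ = trans (cong (ℕ._* 2) (length-map _ reps)) size

  nonzeros : List (Fin q)
  nonzeros = elements ∖ 0#

  nonsquares : List (Fin q)
  nonsquares = filter (¬? ∘ isSquare?) nonzeros

  0-isSquare : IsSquare 0#
  0-isSquare = 0# , zeroˡ 0#

  nonsquare≢0 : ∀ {x} → ¬ IsSquare x → x ≢ 0#
  nonsquare≢0 x∉ refl = x∉ 0-isSquare

  nonzeros-unique : Unique nonzeros
  nonzeros-unique = filter⁺ _ (allFin⁺ q)

  ∈-nonzeros⁺ : ∀ {x} → x ≢ 0# → x ∈ nonzeros
  ∈-nonzeros⁺ = ∈-filter⁺ _ (∈-allFin _)

  ∈-nonzeros⁻ : ∀ {x} → x ∈ nonzeros → x ≢ 0#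
  ∈-nonzeros⁻ x∈ = proj₂ (∈-filter⁻ _ {xs = elements} x∈)

  nonsquares-unique : Unique nonsquares
  nonsquares-unique = filter⁺ _ nonzeros-unique

  ∈-nonsquares⁺ : ∀ {x} → ¬ IsSquare x → x ∈ nonsquares
  ∈-nonsquares⁺ x∉ = ∈-filter⁺ _ (∈-nonzeros⁺ (nonsquare≢0 x∉)) x∉

  ∈-nonsquares⁻ : ∀ {x} → x ∈ nonsquares → ¬ IsSquare x
  ∈-nonsquares⁻ x∈ = proj₂ (∈-filter⁻ (¬? ∘ isSquare?) {xs = nonzeros} x∈)

  -- Squaring is two-to-one on the nonzero elements, so half of these are squares and the complement
  -- is the other half.
  ∣nonsquares∣ : 2# ≢ 0# → suc (length nonsquares ℕ.* 2) ≡ q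
  ∣nonsquares∣ 2≢0 = trans (cong suc
    (trans (cong (ℕ._* 2) (ℕ.+-cancelˡ-≡ (length squares) _ _ halves)) ∣squares∣))
    (trans (length-∖ (allFin⁺ q) (∈-allFin 0#)) ∣elements∣)
    where
    open Squares 2≢0 nonzeros-unique ∈-nonzeros⁻ (∈-nonzeros⁺ ∘ -≢0 ∘ ∈-nonzeros⁻)
    ∣squares∣≡ : length (filter isSquare? nonzeros) ≡ length squares
    ∣squares∣≡ = length-cong (filter⁺ _ nonzeros-unique) squares-unique
      (λ x∈ → case (∈-filter⁻ isSquare? {xs = nonzeros} x∈))
      (λ y∈ → let (x , x∈ , e) = ∈-squares⁻ y∈ ; x≢0 = ∈-nonzeros⁻ x∈ in
         ∈-filter⁺ isSquare? (∈-nonzeros⁺ (subst (_≢ 0#) (sym e) (*≢0 x≢0 x≢0))) (x , sym e))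
      where
      case : ∀ {x} → x ∈ nonzeros × IsSquare x → x ∈ squares
      case (x∈ , y , refl) = ∈-squares⁺ (∈-nonzeros⁺ (*≢0ˡ (∈-nonzeros⁻ x∈)))
    double : ∀ n → n ℕ.* 2 ≡ n ℕ.+ n
    double = solve-∀
    halves : length squares ℕ.+ length nonsquares ≡ length squares ℕ.+ length squares
    halves = trans (cong (ℕ._+ length nonsquares) (sym ∣squares∣≡))
      (trans (length-filter-∁ isSquare? nonzeros) (trans (sym ∣squares∣) (double (length squares))))

-- The subfield K and its squares.

module SubfieldProperties {q r : ℕ} (F : FiniteField q) (K : Subfield F r)
  (k : ℕ) (r≡3+4k : r ≡ 3 ℕ.+ 4 ℕ.* k) (q≡r² : q ≡ r ℕ.* r) where
  open FiniteField F
  open Subfield K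
  open FieldProperties F public

  infix 4 _∈K
  _∈K : Fin q → Set
  x ∈K = member x ≡ true

  _∈K? : Decidable _∈K
  x ∈K? = member x ≟ᵇ true

  ⁻¹-∈K : ∀ {x} → x ≢ 0# → x ∈K → x ⁻¹ ∈K
  ⁻¹-∈K x≢0 x∈ = closed-⁻¹ _ _ x∈ (⁻¹-inverseʳ x≢0)

  2≢0 : 2# ≢ 0#
  2≢0 = odd⇒2≢0 (4 ℕ.+ 12 ℕ.* k ℕ.+ 8 ℕ.* k ℕ.* k)
    (trans q≡r² (trans (cong (λ r → r ℕ.* r) r≡3+4k) (arith k)))
    where
    arith : ∀ k → (3 ℕ.+ 4 ℕ.* k) ℕ.* (3 ℕ.+ 4 ℕ.* k) ≡ suc (2 ℕ.* (4 ℕ.+ 12 ℕ.* k ℕ.+ 8 ℕ.* k ℕ.* k))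
    arith = solve-∀

  2∈K : 2# ∈K
  2∈K = closed-+ _ _ has-1 has-1

  Kelements : List (Fin q)
  Kelements = filterᵇ member elements

  Kelements-unique : Unique Kelements
  Kelements-unique = filter⁺ _ (allFin⁺ q)

  ∈-Kelements⁺ : ∀ {x} → x ∈K → x ∈ Kelements
  ∈-Kelements⁺ x∈ = ∈-filter⁺ (T? ∘ member) (∈-allFin _) (Equivalence.from T-≡ x∈)

  ∈-Kelements⁻ : ∀ {x} → x ∈ Kelements → x ∈K
  ∈-Kelements⁻ x∈ = Equivalence.to T-≡ (proj₂ (∈-filter⁻ (T? ∘ member) {xs = elements} x∈))

  Kunits : List (Fin q)
  Kunits = Kelements ∖ 0#

  Kunits-unique : Unique Kunits
  Kunits-unique = filter⁺ _ Kelements-unique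

  ∈-Kunits⁺ : ∀ {x} → x ∈K → x ≢ 0# → x ∈ Kunits
  ∈-Kunits⁺ x∈ = ∈-filter⁺ _ (∈-Kelements⁺ x∈)

  ∈-Kunits⁻ : ∀ {x} → x ∈ Kunits → x ∈K × x ≢ 0#
  ∈-Kunits⁻ x∈ = let (x∈K , x≢0) = ∈-filter⁻ _ {xs = Kelements} x∈ in ∈-Kelements⁻ x∈K , x≢0

  Kunits-neg : ∀ {x} → x ∈ Kunits → - x ∈ Kunits
  Kunits-neg x∈ = let (x∈K , x≢0) = ∈-Kunits⁻ x∈ in ∈-Kunits⁺ (closed-- _ x∈K) (-≢0 x≢0)

  ∣Kunits∣ : length Kunits ≡ 2 ℕ.+ 4 ℕ.* k
  ∣Kunits∣ = ℕ.suc-injective (trans (length-∖ Kelements-unique (∈-Kelements⁺ has-0)) (trans size r≡3+4k))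

  -- The root is required to lie in K, whereas `IsSquare` allows it anywhere in F. The proof lives
  -- on this difference: -1 is a square only in the second sense.
  KSquare : Fin q → Set
  KSquare x = ∃ λ y → y ∈K × y * y ≡ x

  KSquare? : Decidable KSquare
  KSquare? x = any? λ y → (y ∈K?) ×-dec (y * y ≟ x)

  -- If neither z nor -z were a square, x ↦ -x and x ↦ z/x would generate a Klein
  -- four-group acting freely on K*, whose order is 2 mod 4.
  KSquare-± : ∀ {z} → z ∈K → z ≢ 0# → KSquare z ⊎ KSquare (- z)
  KSquare-± {z} z∈ z≢0 with KSquare? z | KSquare? (- z)
  ... | yes sq | _      = inj₁ sq
  ... | no _   | yes sq = inj₂ sq
  ... | no ¬sq | no ¬sq- = ⊥-elim (ℕ.even≢odd (length reps) k
    (ℕ.*-cancelʳ-≡ _ _ 2 (trans (lhs (length reps)) (trans size′ (trans ∣Kunits∣ (rhs k))))))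
    where
    lhs : ∀ n → 2 ℕ.* n ℕ.* 2 ≡ n ℕ.* 4
    lhs = solve-∀
    rhs : ∀ k → 2 ℕ.+ 4 ℕ.* k ≡ suc (2 ℕ.* k) ℕ.* 2
    rhs = solve-∀
    f g : Fin q → Fin q
    f x = - x
    g x = z * x ⁻¹
    inv : ∀ {x} → x ∈ Kunits → x * x ⁻¹ ≡ 1#
    inv x∈ = ⁻¹-inverseʳ (proj₂ (∈-Kunits⁻ x∈))
    inv-neg : ∀ {x} → x ∈ Kunits → (- x) ⁻¹ ≡ - x ⁻¹
    inv-neg {x} x∈ = ⁻¹-unique (trans (solve 2 (λ x i → :- x :* :- i := x :* i) refl x (x ⁻¹)) (inv x∈))
    g∈ : ∀ {x} → x ∈ Kunits → g x ∈ Kunits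
    g∈ x∈ = let (x∈K , x≢0) = ∈-Kunits⁻ x∈ in
      ∈-Kunits⁺ (closed-* _ _ z∈ (⁻¹-∈K x≢0 x∈K)) (*≢0 z≢0 (⁻¹≢0 x≢0))
    gg : ∀ {x} → x ∈ Kunits → g (g x) ≡ x
    gg {x} x∈ = by₂ (- (z * (z * x ⁻¹) ⁻¹)) x (inv x∈) (inv (g∈ x∈))
      (solve 4 (λ z x i j → z :* j :- x := :- (z :* j) :* (x :* i :- con (+ 1)) :+ x :* (z :* i :* j :- con (+ 1))) refl z x (x ⁻¹) ((z * x ⁻¹) ⁻¹))
    fg : ∀ {x} → x ∈ Kunits → f (g x) ≡ g (f x)
    fg {x} x∈ = trans (solve 2 (λ z i → :- (z :* i) := z :* :- i) refl z (x ⁻¹)) (cong (z *_) (sym (inv-neg x∈)))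
    gx≢x : ∀ {x} → x ∈ Kunits → g x ≢ x
    gx≢x {x} x∈ e = ¬sq (x , proj₁ (∈-Kunits⁻ x∈) , by₂ (- x) z e (inv x∈)
      (solve 3 (λ z x i → x :* x :- z := :- x :* (z :* i :- x) :+ z :* (x :* i :- con (+ 1))) refl z x (x ⁻¹)))
    gfx≢x : ∀ {x} → x ∈ Kunits → g (f x) ≢ x
    gfx≢x {x} x∈ e = ¬sq- (x , proj₁ (∈-Kunits⁻ x∈) , by₂ (- x) (- z) (trans (cong (z *_) (sym (inv-neg x∈))) e) (inv x∈)
      (solve 3 (λ z x i → x :* x :- :- z := :- x :* (z :* :- i :- x) :+ :- z :* (x :* i :- con (+ 1))) refl z x (x ⁻¹)))
    open Transversal (transversal (klein {f} {g} Kunits-unique Kunits-neg g∈ (λ {x} _ → -‿involutive x) gg fg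
      (-x≢x 2≢0 ∘ proj₂ ∘ ∈-Kunits⁻) gx≢x gfx≢x)) renaming (size to size′)

  -- Otherwise every element of K* would be a square, but only half of them are.
  -1-nonsquare : ¬ KSquare (- 1#)
  -1-nonsquare (i , i∈ , i²≡-1) = absurd (length squares) (trans ∣squares∣ ∣Kunits∣)
    (ℕ.≤-trans (ℕ.≤-reflexive ∣squares∣) (length-mono Kunits-unique all-squares))
    where
    open Squares 2≢0 Kunits-unique (proj₂ ∘ ∈-Kunits⁻) Kunits-neg
    all-squares : ∀ {z} → z ∈ Kunits → z ∈ squares
    all-squares {z} z∈ = [ square , square ∘ unneg ]′ (KSquare-± z∈K z≢0)
      where
      z∈K : z ∈K
      z∈K = proj₁ (∈-Kunits⁻ z∈)
      z≢0 : z ≢ 0#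
      z≢0 = proj₂ (∈-Kunits⁻ z∈)
      square : KSquare z → z ∈ squares
      square (y , y∈ , refl) = ∈-squares⁺ (∈-Kunits⁺ y∈ (*≢0ˡ z≢0))
      unneg : KSquare (- z) → KSquare z
      unneg (y , y∈ , e) = i * y , closed-* _ _ i∈ y∈ , by₂ (y * y) (- 1#) i²≡-1 e
        (solve 3 (λ z y i → i :* y :* (i :* y) :- z := y :* y :* (i :* i :- :- con (+ 1)) :+ :- con (+ 1) :* (y :* y :- :- z)) refl z y i)
    absurd : ∀ n → n ℕ.* 2 ≡ 2 ℕ.+ 4 ℕ.* k → n ℕ.* 2 ≤ n → ⊥
    absurd (suc n) _ (s≤s le) = ℕ.<⇒≱ (s≤s (ℕ.m≤m*n n 2)) le

  -- Dividing a root of -x² by x would give a root of -1 in K.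
  -square-nonsquare : ∀ {x} → x ∈K → x ≢ 0# → ¬ KSquare (- (x * x))
  -square-nonsquare {x} x∈ x≢0 (y , y∈ , e) = -1-nonsquare (y * x ⁻¹ , closed-* _ _ y∈ (⁻¹-∈K x≢0 x∈) ,
    by₂ (x ⁻¹ * x ⁻¹) (- (x ⁻¹ * x + 1#)) e (⁻¹-inverseʳ x≢0)
      (solve 3 (λ x y i → y :* i :* (y :* i) :- :- con (+ 1) :=
        i :* i :* (y :* y :- :- (x :* x)) :+ :- (i :* x :+ con (+ 1)) :* (x :* i :- con (+ 1))) refl x y (x ⁻¹)))

  ∃∉K : ∃ λ θ → ¬ θ ∈K
  ∃∉K with any? (λ x → ¬? (x ∈K?))
  ... | yes θ = θ
  ... | no ¬θ = ⊥-elim (absurd k (subst (λ r → r ℕ.* r ≤ r) r≡3+4k (subst₂ _≤_ (trans ∣elements∣ q≡r²) size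
    (length-mono (allFin⁺ q) (λ {x} _ → ∈-Kelements⁺ (decidable-stable (x ∈K?) (λ x∉ → ¬θ (x , x∉))))))))
    where
    absurd : ∀ k → ¬ (3 ℕ.+ 4 ℕ.* k) ℕ.* (3 ℕ.+ 4 ℕ.* k) ≤ 3 ℕ.+ 4 ℕ.* k
    absurd k = ℕ.<⇒≱ (ℕ.m<m*n (3 ℕ.+ 4 ℕ.* k) (3 ℕ.+ 4 ℕ.* k) (s≤s (s≤s z≤n)))

  -- Proved by counting: (a, b) ↦ a + bθ is injective on K × K, since a collision of (a, b) and (c,
  -- d) with b ≠ d would put θ = (c - a)/(b - d) in K. Its r² = q values therefore exhaust F.
  basis : ∀ {θ} → ¬ θ ∈K → ∀ y → ∃ λ a → ∃ λ b → a ∈K × b ∈K × y ≡ a + b * θ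
  basis {θ} θ∉ y =
    let ((a , b) , ab∈ , e) = ∈-map⁻ combination (complete unique (ℕ.≤-reflexive (sym ∣combinations∣)) y)
        (a∈ , b∈) = ∈-cartesianProduct⁻ Kelements Kelements ab∈
    in a , b , ∈-Kelements⁻ a∈ , ∈-Kelements⁻ b∈ , e
    where
    combination : Fin q × Fin q → Fin q
    combination (a , b) = a + b * θ
    pairs : List (Fin q × Fin q)
    pairs = cartesianProduct Kelements Kelements
    injective : ∀ {u v} → u ∈ pairs → v ∈ pairs → combination u ≡ combination v → u ≡ v
    injective {a , b} {c , d} u∈ v∈ e with ∈-cartesianProduct⁻ Kelements Kelements u∈ | ∈-cartesianProduct⁻ Kelements Kelements v∈ | b - d ≟ 0#
    ... | a∈ , b∈ | c∈ , d∈ | yes b-d≡0 = cong₂ _,_ (by₂ 1# (- θ) e b-d≡0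
          (solve 5 (λ a b c d t → a :- c := con (+ 1) :* (a :+ b :* t :- (c :+ d :* t)) :+ :- t :* (b :- d :- con (+ 0))) refl a b c d θ))
          (x-y≡0⇒x≡y b d b-d≡0)
    ... | a∈ , b∈ | c∈ , d∈ | no b-d≢0 = contradiction
          (subst _∈K (by₂ (- (b - d) ⁻¹) θ e (⁻¹-inverseʳ b-d≢0)
            (solve 6 (λ a b c d t i → (c :- a) :* i :- t := :- i :* (a :+ b :* t :- (c :+ d :* t)) :+ t :* ((b :- d) :* i :- con (+ 1))) refl a b c d θ ((b - d) ⁻¹)))
            (closed-* _ _ (minus (∈-Kelements⁻ c∈) (∈-Kelements⁻ a∈)) (⁻¹-∈K b-d≢0 (minus (∈-Kelements⁻ b∈) (∈-Kelements⁻ d∈)))))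
          θ∉
      where
      minus : ∀ {x y} → x ∈K → y ∈K → x - y ∈K
      minus x∈ y∈ = closed-+ _ _ x∈ (closed-- _ y∈)
    unique : Unique (map combination pairs)
    unique = map-unique injective (cartesianProduct⁺ Kelements-unique Kelements-unique)
    ∣combinations∣ : length (map combination pairs) ≡ q
    ∣combinations∣ = trans (length-map combination pairs)
      (trans (length-cartesianProduct Kelements Kelements) (trans (cong₂ ℕ._*_ size size) (sym q≡r²)))

  half : Fin q → Fin q
  half x = x * 2# ⁻¹

  half-∈K : ∀ {x} → x ∈K → half x ∈K
  half-∈K x∈ = closed-* _ _ x∈ (⁻¹-∈K 2≢0 2∈K)

  half+half : ∀ x → half x + half x ≡ x
  half+half x = by₁ x (⁻¹-inverseʳ 2≢0)
    (solve 2 (λ x h → x :* h :+ x :* h :- x := x :* (con (+ 2) :* h :- con (+ 1))) refl x (2# ⁻¹))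

  -- Completing the square for a generator of F over K gives θ ∉ K with θ² ∈ K; as θ² is
  -- not a square in K, it is -m² with m ∈ K, and θ/m is a square root of -1.
  -1-isSquare : IsSquare (- 1#)
  -1-isSquare with ∃∉K
  ... | θ , θ∉ with basis θ∉ (θ * θ)
  ... | a , b , a∈ , b∈ , e = [ ⊥-elim ∘ n-nonsquare , root ]′ (KSquare-± n∈ n≢0)
    where
    h η n : Fin q
    h = half b
    η = θ - h
    n = a + h * h
    h∈ : h ∈K
    h∈ = half-∈K b∈
    n∈ : n ∈K
    n∈ = closed-+ _ _ a∈ (closed-* _ _ h∈ h∈)
    η²≡n : η * η ≡ n
    η²≡n = by₂ 1# (- θ) e (half+half b)
      (solve 4 (λ t a b h → (t :- h) :* (t :- h) :- (a :+ h :* h) :=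
        con (+ 1) :* (t :* t :- (a :+ b :* t)) :+ :- t :* (h :+ h :- b)) refl θ a b h)
    η∉ : ¬ η ∈K
    η∉ η∈ = θ∉ (subst _∈K (solve 2 (λ t h → t :- h :+ h := t) refl θ h) (closed-+ _ _ η∈ h∈))
    n-nonsquare : ¬ KSquare n
    n-nonsquare (y , y∈ , y²≡n) = η∉ ([ (λ { refl → y∈ }) , (λ η≡-y → subst _∈K (sym η≡-y) (closed-- _ y∈)) ]′
      (square-injective {y} {η} (trans y²≡n (sym η²≡n))))
    n≢0 : n ≢ 0#
    n≢0 n≡0 = n-nonsquare (0# , has-0 , trans (zeroˡ 0#) (sym n≡0))
    root : KSquare (- n) → IsSquare (- 1#)
    root (m , m∈ , m²≡-n) = η * m ⁻¹ , by₂ (m ⁻¹ * m ⁻¹) (- (m ⁻¹ * m + 1#))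
      (trans η²≡n (trans (sym (-‿involutive n)) (cong -_ (sym m²≡-n)))) (⁻¹-inverseʳ m≢0)
      (solve 3 (λ m e i → e :* i :* (e :* i) :- :- con (+ 1) :=
        i :* i :* (e :* e :- :- (m :* m)) :+ :- (i :* m :+ con (+ 1)) :* (m :* i :- con (+ 1))) refl m η (m ⁻¹))
      where
      m≢0 : m ≢ 0#
      m≢0 = *≢0ˡ (subst (_≢ 0#) (sym m²≡-n) (-≢0 n≢0))

  -isSquare : ∀ {x} → IsSquare x → IsSquare (- x)
  -isSquare (y , refl) = let (i , i²≡-1) = -1-isSquare in i * y , by₁ (y * y) i²≡-1
    (solve 2 (λ i y → i :* y :* (i :* y) :- :- (y :* y) := y :* y :* (i :* i :- :- con (+ 1))) refl i y)

  -- A nonzero element of K is plus or minus a square of K, and the sign is absorbed by a root of -1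
  -- in F.
  K⇒isSquare : ∀ {x} → x ∈K → IsSquare x
  K⇒isSquare {x} x∈ with x ≟ 0#
  ... | yes refl = 0-isSquare
  ... | no x≢0 = [ (λ (y , _ , e) → y , e)
                 , (λ (y , _ , e) → subst IsSquare (-‿involutive x) (-isSquare (y , e))) ]′ (KSquare-± x∈ x≢0)

-- The action of G and its orbit relation.

module Orbits {q r : ℕ} (F : FiniteField q) (K : Subfield F r)
  (k : ℕ) (r≡3+4k : r ≡ 3 ℕ.+ 4 ℕ.* k) (q≡r² : q ≡ r ℕ.* r) where
  open FiniteField F
  open Subfield K
  open SubfieldProperties F K k r≡3+4k q≡r²
  open Plane F hiding (IsSquare)
  open WithSubfield K

  triple-≡ : ∀ {x y z x′ y′ z′ : Fin q} → x ≡ x′ → y ≡ y′ → z ≡ z′ → _≡_ {A = Vec3} (x , y , z) (x′ , y′ , z′)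
  triple-≡ refl refl refl = refl

  -- The matrix of (a, b, c, d) is the symmetric square of the substitution (t, u) ↦ (at + cu, bt + du).
  actG-∘ : ∀ a b c d a′ b′ c′ d′ P → actG a′ b′ c′ d′ (actG a b c d P) ≡
    actG (a′ * a + c′ * b) (b′ * a + d′ * b) (a′ * c + c′ * d) (b′ * c + d′ * d) P
  actG-∘ a b c d a′ b′ c′ d′ (x , y , z) = triple-≡ (outer a′ c′) middle (outer b′ d′)
    where
    outer : ∀ e f → _
    outer e f = solve 9 (λ a b c d e f x y z →
      e :* e :* (a :* a :* x :+ con (+ 2) :* a :* c :* y :+ c :* c :* z)
        :+ con (+ 2) :* e :* f :* (a :* b :* x :+ (a :* d :+ b :* c) :* y :+ c :* d :* z)
        :+ f :* f :* (b :* b :* x :+ con (+ 2) :* b :* d :* y :+ d :* d :* z)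
      := (e :* a :+ f :* b) :* (e :* a :+ f :* b) :* x
        :+ con (+ 2) :* (e :* a :+ f :* b) :* (e :* c :+ f :* d) :* y
        :+ (e :* c :+ f :* d) :* (e :* c :+ f :* d) :* z) refl a b c d e f x y z
    middle : _
    middle = solve 11 (λ a b c d a′ b′ c′ d′ x y z →
      a′ :* b′ :* (a :* a :* x :+ con (+ 2) :* a :* c :* y :+ c :* c :* z)
        :+ (a′ :* d′ :+ b′ :* c′) :* (a :* b :* x :+ (a :* d :+ b :* c) :* y :+ c :* d :* z)
        :+ c′ :* d′ :* (b :* b :* x :+ con (+ 2) :* b :* d :* y :+ d :* d :* z)
      := (a′ :* a :+ c′ :* b) :* (b′ :* a :+ d′ :* b) :* x
        :+ ((a′ :* a :+ c′ :* b) :* (b′ :* c :+ d′ :* d) :+ (b′ :* a :+ d′ :* b) :* (a′ :* c :+ c′ :* d)) :* y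
        :+ (a′ :* c :+ c′ :* d) :* (b′ :* c :+ d′ :* d) :* z) refl a b c d a′ b′ c′ d′ x y z

  det-∘ : ∀ a b c d a′ b′ c′ d′ →
    (a′ * a + c′ * b) * (b′ * c + d′ * d) - (b′ * a + d′ * b) * (a′ * c + c′ * d) ≡
    (a′ * d′ - b′ * c′) * (a * d - b * c)
  det-∘ = solve 8 (λ a b c d a′ b′ c′ d′ →
    (a′ :* a :+ c′ :* b) :* (b′ :* c :+ d′ :* d) :- (b′ :* a :+ d′ :* b) :* (a′ :* c :+ c′ :* d) :=
    (a′ :* d′ :- b′ :* c′) :* (a :* d :- b :* c)) refl

  actG-scale : ∀ a b c d t P → actG a b c d (scale t P) ≡ scale t (actG a b c d P)
  actG-scale a b c d t (x , y , z) = triple-≡ (linear _ _ _) (linear _ _ _) (linear _ _ _)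
    where
    linear : ∀ e f g → e * (t * x) + f * (t * y) + g * (t * z) ≡ t * (e * x + f * y + g * z)
    linear e f g = solve 7 (λ e f g t x y z →
      e :* (t :* x) :+ f :* (t :* y) :+ g :* (t :* z) := t :* (e :* x :+ f :* y :+ g :* z)) refl e f g t x y z

  scale-scale : ∀ t u P → scale t (scale u P) ≡ scale (t * u) P
  scale-scale t u (x , y , z) = triple-≡ (sym (*-assoc t u x)) (sym (*-assoc t u y)) (sym (*-assoc t u z))

  scale-1 : ∀ P → scale 1# P ≡ P
  scale-1 (x , y , z) = triple-≡ (*-identityˡ x) (*-identityˡ y) (*-identityˡ z)

  -- A two-by-two matrix times its adjugate is the scalar matrix of the determinant, and the
  -- symmetric square of that is the scalar det². This supplies inverses without division.
  actG-adjugate : ∀ a b c d P → actG d (- b) (- c) a (actG a b c d P) ≡ scale ((a * d - b * c) * (a * d - b * c)) P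
  actG-adjugate a b c d (x , y , z) = triple-≡
    (solve 7 (λ a b c d x y z → (d :* d :* (a :* a :* x :+ con (+ 2) :* a :* c :* y :+ c :* c :* z)
        :+ con (+ 2) :* d :* :- c :* (a :* b :* x :+ (a :* d :+ b :* c) :* y :+ c :* d :* z)
        :+ :- c :* :- c :* (b :* b :* x :+ con (+ 2) :* b :* d :* y :+ d :* d :* z))
      := (a :* d :- b :* c) :* (a :* d :- b :* c) :* x) refl a b c d x y z)
    (solve 7 (λ a b c d x y z → (d :* :- b :* (a :* a :* x :+ con (+ 2) :* a :* c :* y :+ c :* c :* z)
        :+ (d :* a :+ :- b :* :- c) :* (a :* b :* x :+ (a :* d :+ b :* c) :* y :+ c :* d :* z)
        :+ :- c :* a :* (b :* b :* x :+ con (+ 2) :* b :* d :* y :+ d :* d :* z))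
      := (a :* d :- b :* c) :* (a :* d :- b :* c) :* y) refl a b c d x y z)
    (solve 7 (λ a b c d x y z → (:- b :* :- b :* (a :* a :* x :+ con (+ 2) :* a :* c :* y :+ c :* c :* z)
        :+ con (+ 2) :* :- b :* a :* (a :* b :* x :+ (a :* d :+ b :* c) :* y :+ c :* d :* z)
        :+ a :* a :* (b :* b :* x :+ con (+ 2) :* b :* d :* y :+ d :* d :* z))
      := (a :* d :- b :* c) :* (a :* d :- b :* c) :* z) refl a b c d x y z)

  det-adjugate : ∀ a b c d → d * a - - b * - c ≡ a * d - b * c
  det-adjugate = solve 4 (λ a b c d → d :* a :- :- b :* :- c := a :* d :- b :* c) refl

  combination-∈K : ∀ {a b c d} → a ∈K → b ∈K → c ∈K → d ∈K → a * b + c * d ∈K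
  combination-∈K a∈ b∈ c∈ d∈ = closed-+ _ _ (closed-* _ _ a∈ b∈) (closed-* _ _ c∈ d∈)

  orbit-trans : ∀ {P Q R} → InOrbit P Q → InOrbit Q R → InOrbit P R
  orbit-trans {P} (a , b , c , d , a∈ , b∈ , c∈ , d∈ , det≢0 , t , t≢0 , refl)
                  (a′ , b′ , c′ , d′ , a′∈ , b′∈ , c′∈ , d′∈ , det′≢0 , t′ , t′≢0 , refl) =
    a′ * a + c′ * b , b′ * a + d′ * b , a′ * c + c′ * d , b′ * c + d′ * d ,
    combination-∈K a′∈ a∈ c′∈ b∈ , combination-∈K b′∈ a∈ d′∈ b∈ ,
    combination-∈K a′∈ c∈ c′∈ d∈ , combination-∈K b′∈ c∈ d′∈ d∈ ,
    subst (_≢ 0#) (sym (det-∘ a b c d a′ b′ c′ d′)) (*≢0 det′≢0 det≢0) ,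
    t′ * t , *≢0 t′≢0 t≢0 ,
    trans (cong (scale t′) (actG-scale a′ b′ c′ d′ t (actG a b c d P)))
      (trans (scale-scale t′ t _) (cong (scale (t′ * t)) (actG-∘ a b c d a′ b′ c′ d′ P)))

  orbit-sym : ∀ {P Q} → InOrbit P Q → InOrbit Q P
  orbit-sym {P} (a , b , c , d , a∈ , b∈ , c∈ , d∈ , det≢0 , t , t≢0 , refl) =
    d , - b , - c , a , d∈ , closed-- _ b∈ , closed-- _ c∈ , a∈ ,
    subst (_≢ 0#) (sym (det-adjugate a b c d)) det≢0 ,
    u ⁻¹ , ⁻¹≢0 u≢0 , sym (begin
      scale (u ⁻¹) (actG d (- b) (- c) a (scale t (actG a b c d P)))
        ≡⟨ cong (scale (u ⁻¹)) (actG-scale d (- b) (- c) a t (actG a b c d P)) ⟩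
      scale (u ⁻¹) (scale t (actG d (- b) (- c) a (actG a b c d P)))
        ≡⟨ cong (scale (u ⁻¹) ∘ scale t) (actG-adjugate a b c d P) ⟩
      scale (u ⁻¹) (scale t (scale D² P))
        ≡⟨ cong (scale (u ⁻¹)) (scale-scale t D² P) ⟩
      scale (u ⁻¹) (scale u P)
        ≡⟨ scale-scale (u ⁻¹) u P ⟩
      scale (u ⁻¹ * u) P
        ≡⟨ cong (λ e → scale e P) (trans (*-comm (u ⁻¹) u) (⁻¹-inverseʳ u≢0)) ⟩
      scale 1# P
        ≡⟨ scale-1 P ⟩
      P ∎)
    where
    open ≡-Reasoning
    D² u : Fin q
    D² = (a * d - b * c) * (a * d - b * c)
    u = t * D²
    u≢0 : u ≢ 0#
    u≢0 = *≢0 t≢0 (*≢0 det≢0 det≢0)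

  orbit-scale : ∀ P {t} → t ≢ 0# → InOrbit P (scale t P)
  orbit-scale P@(x , y , z) {t} t≢0 = 1# , 0# , 0# , 1# , has-1 , has-0 , has-0 , has-1 ,
    subst (_≢ 0#) (solve 0 (con (+ 1) := con (+ 1) :* con (+ 1) :- con (+ 0) :* con (+ 0)) refl) 1≢0 ,
    t , t≢0 , cong (scale t) (triple-≡
      (solve 3 (λ x y z → x := con (+ 1) :* con (+ 1) :* x :+ con (+ 2) :* con (+ 1) :* con (+ 0) :* y :+ con (+ 0) :* con (+ 0) :* z) refl x y z)
      (solve 3 (λ x y z → y := con (+ 1) :* con (+ 0) :* x :+ (con (+ 1) :* con (+ 1) :+ con (+ 0) :* con (+ 0)) :* y :+ con (+ 0) :* con (+ 1) :* z) refl x y z)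
      (solve 3 (λ x y z → z := con (+ 0) :* con (+ 0) :* x :+ con (+ 2) :* con (+ 0) :* con (+ 1) :* y :+ con (+ 1) :* con (+ 1) :* z) refl x y z))

  orbit-refl : ∀ P → InOrbit P P
  orbit-refl P = subst (InOrbit P) (scale-1 P) (orbit-scale P 1≢0)

  orbit-actG : ∀ a b c d P → a ∈K → b ∈K → c ∈K → d ∈K → a * d - b * c ≢ 0# → InOrbit P (actG a b c d P)
  orbit-actG a b c d P a∈ b∈ c∈ d∈ det≢0 =
    a , b , c , d , a∈ , b∈ , c∈ , d∈ , det≢0 , 1# , 1≢0 , sym (scale-1 (actG a b c d P))

  -- The points (1, 0, s): internality and conjugacy.

  pt : Fin q → Vec3
  pt s = 1# , 0# , s

  -- The form changes by the square of t * det, so its being a square or not is an invariant of the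
  -- orbit.
  Qform-orbit : ∀ a b c d t P → Qform (scale t (actG a b c d P)) ≡
    t * (a * d - b * c) * (t * (a * d - b * c)) * Qform P
  Qform-orbit a b c d t (x , y , z) = solve 8 (λ a b c d t x y z →
    t :* (a :* b :* x :+ (a :* d :+ b :* c) :* y :+ c :* d :* z) :* (t :* (a :* b :* x :+ (a :* d :+ b :* c) :* y :+ c :* d :* z))
    :- t :* (a :* a :* x :+ con (+ 2) :* a :* c :* y :+ c :* c :* z) :* (t :* (b :* b :* x :+ con (+ 2) :* b :* d :* y :+ d :* d :* z))
    := t :* (a :* d :- b :* c) :* (t :* (a :* d :- b :* c)) :* (y :* y :- x :* z)) refl a b c d t x y z

  isSquare-cancel : ∀ {u x} → u ≢ 0# → IsSquare (u * u * x) → IsSquare x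
  isSquare-cancel {u} {x} u≢0 (y , e) = y * u ⁻¹ , by₂ (u ⁻¹ * u ⁻¹) (x * (u * u ⁻¹ + 1#)) e (⁻¹-inverseʳ u≢0)
    (solve 4 (λ u x y i → y :* i :* (y :* i) :- x :=
      i :* i :* (y :* y :- u :* u :* x) :+ x :* (u :* i :+ con (+ 1)) :* (u :* i :- con (+ 1))) refl u x y (u ⁻¹))

  nonsquare⇒Internal : ∀ {P} → ¬ IsSquare (Qform P) → Internal P
  nonsquare⇒Internal ¬sq = nonsquare≢0 ¬sq , ¬sq

  orbit-Internal : ∀ {P X} → Internal P → InOrbit P X → Internal X
  orbit-Internal {P} (_ , ¬sq) (a , b , c , d , _ , _ , _ , _ , det≢0 , t , t≢0 , refl) = nonsquare⇒Internal
    (¬sq ∘ isSquare-cancel (*≢0 t≢0 det≢0) ∘ subst IsSquare (Qform-orbit a b c d t P))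

  Qform-pt : ∀ s → Qform (pt s) ≡ - s
  Qform-pt = solve 1 (λ s → con (+ 0) :* con (+ 0) :- con (+ 1) :* s := :- s) refl

  -- The form takes the value -s at this point, and the sign is harmless because -1 is a square in
  -- F.
  pt-Internal⁺ : ∀ {s} → ¬ IsSquare s → Internal (pt s)
  pt-Internal⁺ {s} ¬sq = nonsquare⇒Internal
    (¬sq ∘ subst IsSquare (-‿involutive s) ∘ -isSquare ∘ subst IsSquare (Qform-pt s))

  pt-Internal⁻ : ∀ {s} → Internal (pt s) → ¬ IsSquare s
  pt-Internal⁻ {s} (_ , ¬sq) = ¬sq ∘ subst IsSquare (sym (Qform-pt s)) ∘ -isSquare

  nonsquare∉K : ∀ {s} → ¬ IsSquare s → ¬ s ∈K
  nonsquare∉K ¬sq = ¬sq ∘ K⇒isSquare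

  independent : ∀ {s} → ¬ s ∈K → ∀ {a b} → a ∈K → b ∈K → a * s + b ≡ 0# → a ≡ 0# × b ≡ 0#
  independent {s} s∉ {a} {b} a∈ b∈ e with a ≟ 0#
  ... | yes refl = refl , trans (solve 2 (λ s b → b := con (+ 0) :* s :+ b) refl s b) e
  ... | no a≢0 = contradiction (subst _∈K (by₂ (- a ⁻¹) s e (⁻¹-inverseʳ a≢0)
      (solve 4 (λ s a b i → i :* :- b :- s := :- i :* (a :* s :+ b :- con (+ 0)) :+ s :* (a :* i :- con (+ 1))) refl s a b (a ⁻¹)))
      (closed-* _ _ (⁻¹-∈K a≢0 a∈) (closed-- _ b∈))) s∉

  -- If d were nonzero, -d² would be the square of a in K.
  sum-of-squares : ∀ {a d} → a ∈K → d ∈K → a * a + d * d ≡ 0# → a ≡ 0# × d ≡ 0#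
  sum-of-squares {a} {d} a∈ d∈ e with d ≟ 0#
  ... | yes refl = square≡0 (trans (solve 1 (λ a → a :* a := a :* a :+ con (+ 0) :* con (+ 0)) refl a) e) , refl
  ... | no d≢0 = contradiction (a , a∈ , by₁ 1# e
      (solve 2 (λ a d → a :* a :- :- (d :* d) := con (+ 1) :* (a :* a :+ d :* d :- con (+ 0))) refl a d)) (-square-nonsquare d∈ d≢0)

  -- The incidence reads c²s² + (a² + d²)s + b² = 0, that is (cs + b)² = (2bc - a² - d²)s;
  -- the factor 2bc - a² - d² lies in K and so is a square in F.
  pt-not-OnPerp : ∀ {s} → ¬ IsSquare s → ∀ {a b c d} → a ∈K → b ∈K → c ∈K → d ∈K → a * d - b * c ≢ 0# →
    ¬ OnPerp (pt s) (actG a b c d (pt s))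
  pt-not-OnPerp {s} ¬sq {a} {b} {c} {d} a∈ b∈ c∈ d∈ det≢0 perp = case (K⇒isSquare e∈)
    where
    e : Fin q
    e = 2# * b * c - (a * a + d * d)
    e∈ : e ∈K
    e∈ = closed-+ _ _ (closed-* _ _ (closed-* _ _ 2∈K b∈) c∈) (closed-- _ (combination-∈K a∈ a∈ d∈ d∈))
    key : (c * s + b) * (c * s + b) ≡ e * s
    key = by₁ 1# perp (solve 5 (λ a b c d s →
      (c :* s :+ b) :* (c :* s :+ b) :- (con (+ 2) :* b :* c :- (a :* a :+ d :* d)) :* s :=
      con (+ 1) :* (s :* (a :* a :* con (+ 1) :+ con (+ 2) :* a :* c :* con (+ 0) :+ c :* c :* s)
        :- con (+ 2) :* con (+ 0) :* (a :* b :* con (+ 1) :+ (a :* d :+ b :* c) :* con (+ 0) :+ c :* d :* s)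
        :+ con (+ 1) :* (b :* b :* con (+ 1) :+ con (+ 2) :* b :* d :* con (+ 0) :+ d :* d :* s) :- con (+ 0))) refl a b c d s)
    -- A vanishing factor is a square too, but cannot be divided out. Here cs + b = 0 forces b = c =
    -- 0, then a² + d² = 0 forces a = d = 0, and the matrix is singular.
    degenerate : e ≡ 0# → ⊥
    degenerate e≡0 with independent (nonsquare∉K ¬sq) c∈ b∈ (square≡0 (trans key (trans (cong (_* s) e≡0) (zeroˡ s))))
    ... | refl , refl with sum-of-squares a∈ d∈ (by₁ (- 1#) e≡0 (solve 2 (λ a d → a :* a :+ d :* d :- con (+ 0) :=
          :- con (+ 1) :* (con (+ 2) :* con (+ 0) :* con (+ 0) :- (a :* a :+ d :* d) :- con (+ 0))) refl a d))
    ... | refl , refl = det≢0 (solve 0 (con (+ 0) :* con (+ 0) :- con (+ 0) :* con (+ 0) := con (+ 0)) refl)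
    case : IsSquare e → ⊥
    case (w , w²≡e) with w ≟ 0#
    ... | yes refl = degenerate (trans (sym w²≡e) (zeroˡ 0#))
    ... | no w≢0 = ¬sq (isSquare-cancel w≢0 (c * s + b , trans key (cong (_* s) (sym w²≡e))))

  -- With respect to the polar form, the adjoint of a matrix of G is the action of the adjugate.
  -- Conjugacy of two points of an orbit thus reduces to conjugacy of the base point and one image
  -- of it.
  OnPerp-adjoint : ∀ a b c d {t t′} → t ≢ 0# → t′ ≢ 0# → ∀ P R →
    OnPerp (scale t (actG a b c d P)) (scale t′ R) → OnPerp P (actG d (- b) (- c) a R)
  OnPerp-adjoint a b c d {t} {t′} t≢0 t′≢0 (x , y , z) (x′ , y′ , z′) perp = integral (trans (solve 12 (λ a b c d t t′ x y z x′ y′ z′ →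
      t :* t′ :* (z :* (d :* d :* x′ :+ con (+ 2) :* d :* :- c :* y′ :+ :- c :* :- c :* z′)
        :- con (+ 2) :* y :* (d :* :- b :* x′ :+ (d :* a :+ :- b :* :- c) :* y′ :+ :- c :* a :* z′)
        :+ x :* (:- b :* :- b :* x′ :+ con (+ 2) :* :- b :* a :* y′ :+ a :* a :* z′)) :=
      t :* (b :* b :* x :+ con (+ 2) :* b :* d :* y :+ d :* d :* z) :* (t′ :* x′)
        :- con (+ 2) :* (t :* (a :* b :* x :+ (a :* d :+ b :* c) :* y :+ c :* d :* z)) :* (t′ :* y′)
        :+ t :* (a :* a :* x :+ con (+ 2) :* a :* c :* y :+ c :* c :* z) :* (t′ :* z′)) refl a b c d t t′ x y z x′ y′ z′) perp)
      (*≢0 t≢0 t′≢0)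

  pt-GoodOrbit : ∀ {s} → ¬ IsSquare s → GoodOrbit (pt s)
  pt-GoodOrbit {s} ¬sq = (λ X → orbit-Internal (pt-Internal⁺ ¬sq)) , not-perp
    where
    not-perp : ∀ X Y → InOrbit (pt s) X → InOrbit (pt s) Y → ¬ OnPerp X Y
    not-perp _ _ (a , b , c , d , a∈ , b∈ , c∈ , d∈ , det≢0 , t , t≢0 , refl)
                 (a′ , b′ , c′ , d′ , a′∈ , b′∈ , c′∈ , d′∈ , det′≢0 , t′ , t′≢0 , refl) perp =
      pt-not-OnPerp ¬sq
        (combination-∈K d∈ a′∈ -c∈ b′∈) (combination-∈K -b∈ a′∈ a∈ b′∈)
        (combination-∈K d∈ c′∈ -c∈ d′∈) (combination-∈K -b∈ c′∈ a∈ d′∈)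
        (subst (_≢ 0#) (sym (det-∘ a′ b′ c′ d′ d (- b) (- c) a))
          (*≢0 (subst (_≢ 0#) (sym (det-adjugate a b c d)) det≢0) det′≢0))
        (subst (OnPerp (pt s)) (actG-∘ a′ b′ c′ d′ d (- b) (- c) a (pt s))
          (OnPerp-adjoint a b c d t≢0 t′≢0 (pt s) (actG a′ b′ c′ d′ (pt s)) perp))
      where
      -b∈ : - b ∈K
      -b∈ = closed-- _ b∈
      -c∈ : - c ∈K
      -c∈ = closed-- _ c∈

  -- When two points (1, 0, s) and (1, 0, t) share an orbit.

  Linked : Fin q → Fin q → Set
  Linked s t = ∃ λ k → k ∈K × k ≢ 0# × (t ≡ k * k * s ⊎ t * s ≡ k * k)

  -- The middle coordinate of the image, cds + ab up to a factor, must vanish. As s is not in K,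
  -- this gives cd = ab = 0, and with a nonzero determinant only diagonal and antidiagonal matrices
  -- survive. They yield k = d/a with t = k²s, and k = b/c with ts = k².
  orbit⇒Linked : ∀ {s t} → ¬ IsSquare s → InOrbit (pt s) (pt t) → Linked s t
  orbit⇒Linked {s} {t} ¬sq (a , b , c , d , a∈ , b∈ , c∈ , d∈ , det≢0 , u , u≢0 , e) = cases
    (independent (nonsquare∉K ¬sq) (closed-* _ _ c∈ d∈) (closed-* _ _ a∈ b∈) (integral (trans
      (solve 6 (λ a b c d s u → u :* (c :* d :* s :+ a :* b) :=
        u :* (a :* b :* con (+ 1) :+ (a :* d :+ b :* c) :* con (+ 0) :+ c :* d :* s)) refl a b c d s u)
      (sym (cong (proj₁ ∘ proj₂) e))) u≢0))
    where
    e₁ : 1# ≡ u * (a * a * 1# + 2# * a * c * 0# + c * c * s)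
    e₁ = cong proj₁ e
    e₃ : t ≡ u * (b * b * 1# + 2# * b * d * 0# + d * d * s)
    e₃ = cong (proj₂ ∘ proj₂) e
    antidiagonal : a ≡ 0# → d ≡ 0# → Linked s t
    antidiagonal refl refl = b * c ⁻¹ , closed-* _ _ b∈ (⁻¹-∈K c≢0 c∈) , *≢0 b≢0 (⁻¹≢0 c≢0) , inj₂
      (trans (cong (_* s) e₃) (by₂ (- (b * b * c ⁻¹ * c ⁻¹)) (- (u * b * b * s * (c * c ⁻¹ + 1#))) e₁ (⁻¹-inverseʳ c≢0)
        (solve 5 (λ b c s u i →
          u :* (b :* b :* con (+ 1) :+ con (+ 2) :* b :* con (+ 0) :* con (+ 0) :+ con (+ 0) :* con (+ 0) :* s) :* s :- b :* i :* (b :* i) :=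
          :- (b :* b :* i :* i) :* (con (+ 1) :- u :* (con (+ 0) :* con (+ 0) :* con (+ 1) :+ con (+ 2) :* con (+ 0) :* c :* con (+ 0) :+ c :* c :* s))
          :+ :- (u :* b :* b :* s :* (c :* i :+ con (+ 1))) :* (c :* i :- con (+ 1))) refl b c s u (c ⁻¹))))
      where
      bc≢0 : b * c ≢ 0#
      bc≢0 bc≡0 = det≢0 (by₁ (- 1#) bc≡0 (solve 2 (λ b c →
        con (+ 0) :* con (+ 0) :- b :* c :- con (+ 0) := :- con (+ 1) :* (b :* c :- con (+ 0))) refl b c))
      b≢0 : b ≢ 0#
      b≢0 = *≢0ˡ bc≢0
      c≢0 : c ≢ 0#
      c≢0 = *≢0ˡ (subst (_≢ 0#) (*-comm b c) bc≢0)
    diagonal : b ≡ 0# → c ≡ 0# → Linked s t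
    diagonal refl refl = d * a ⁻¹ , closed-* _ _ d∈ (⁻¹-∈K a≢0 a∈) , *≢0 d≢0 (⁻¹≢0 a≢0) , inj₁
      (trans e₃ (by₂ (- (d * d * s * a ⁻¹ * a ⁻¹)) (- (u * d * d * s * (a * a ⁻¹ + 1#))) e₁ (⁻¹-inverseʳ a≢0)
        (solve 5 (λ a d s u i →
          u :* (con (+ 0) :* con (+ 0) :* con (+ 1) :+ con (+ 2) :* con (+ 0) :* d :* con (+ 0) :+ d :* d :* s) :- d :* i :* (d :* i) :* s :=
          :- (d :* d :* s :* i :* i) :* (con (+ 1) :- u :* (a :* a :* con (+ 1) :+ con (+ 2) :* a :* con (+ 0) :* con (+ 0) :+ con (+ 0) :* con (+ 0) :* s))
          :+ :- (u :* d :* d :* s :* (a :* i :+ con (+ 1))) :* (a :* i :- con (+ 1))) refl a d s u (a ⁻¹))))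
      where
      ad≢0 : a * d ≢ 0#
      ad≢0 ad≡0 = det≢0 (by₁ 1# ad≡0 (solve 2 (λ a d →
        a :* d :- con (+ 0) :* con (+ 0) :- con (+ 0) := con (+ 1) :* (a :* d :- con (+ 0))) refl a d))
      a≢0 : a ≢ 0#
      a≢0 = *≢0ˡ ad≢0
      d≢0 : d ≢ 0#
      d≢0 = *≢0ˡ (subst (_≢ 0#) (*-comm a d) ad≢0)
    cases : c * d ≡ 0# × a * b ≡ 0# → Linked s t
    cases (cd≡0 , ab≡0) with a ≟ 0# | c ≟ 0#
    ... | no a≢0  | yes c≡0 = diagonal (integral ab≡0 a≢0) c≡0
    ... | yes a≡0 | no c≢0  = antidiagonal a≡0 (integral cd≡0 c≢0)
    ... | yes refl | yes refl = contradiction (solve 2 (λ b d → con (+ 0) :* d :- b :* con (+ 0) := con (+ 0)) refl b d) det≢0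
    ... | no a≢0  | no c≢0 = contradiction (trans (cong₂ (λ b d → a * d - b * c) (integral ab≡0 a≢0) (integral cd≡0 c≢0))
          (solve 2 (λ a c → a :* con (+ 0) :- con (+ 0) :* c := con (+ 0)) refl a c)) det≢0

  Linked⇒orbit : ∀ {s t} → ¬ IsSquare s → Linked s t → InOrbit (pt s) (pt t)
  Linked⇒orbit {s} ¬sq (k , k∈ , k≢0 , inj₁ refl) = 1# , 0# , 0# , k , has-1 , has-0 , has-0 , k∈ ,
    subst (_≢ 0#) (solve 1 (λ k → k := con (+ 1) :* k :- con (+ 0) :* con (+ 0)) refl k) k≢0 , 1# , 1≢0 ,
    triple-≡
      (solve 1 (λ s → con (+ 1) := con (+ 1) :* (con (+ 1) :* con (+ 1) :* con (+ 1) :+ con (+ 2) :* con (+ 1) :* con (+ 0) :* con (+ 0) :+ con (+ 0) :* con (+ 0) :* s)) refl s)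
      (solve 2 (λ k s → con (+ 0) := con (+ 1) :* (con (+ 1) :* con (+ 0) :* con (+ 1) :+ (con (+ 1) :* k :+ con (+ 0) :* con (+ 0)) :* con (+ 0) :+ con (+ 0) :* k :* s)) refl k s)
      (solve 2 (λ k s → k :* k :* s := con (+ 1) :* (con (+ 0) :* con (+ 0) :* con (+ 1) :+ con (+ 2) :* con (+ 0) :* k :* con (+ 0) :+ k :* k :* s)) refl k s)
  -- This antidiagonal matrix sends (1, 0, s) to (s, 0, k²), which the scalar 1/s normalises to (1,
  -- 0, t).
  Linked⇒orbit {s} {t} ¬sq (k , k∈ , k≢0 , inj₂ ts≡k²) = 0# , k , 1# , 0# , has-0 , k∈ , has-1 , has-0 ,
    subst (_≢ 0#) (solve 1 (λ k → :- k := con (+ 0) :* con (+ 0) :- k :* con (+ 1)) refl k) (-≢0 k≢0) , s ⁻¹ , ⁻¹≢0 s≢0 ,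
    triple-≡
      (sym (trans (solve 2 (λ s i → i :* (con (+ 0) :* con (+ 0) :* con (+ 1) :+ con (+ 2) :* con (+ 0) :* con (+ 1) :* con (+ 0) :+ con (+ 1) :* con (+ 1) :* s) := s :* i) refl s (s ⁻¹)) (⁻¹-inverseʳ s≢0)))
      (solve 3 (λ k s i → con (+ 0) := i :* (con (+ 0) :* k :* con (+ 1) :+ (con (+ 0) :* con (+ 0) :+ k :* con (+ 1)) :* con (+ 0) :+ con (+ 1) :* con (+ 0) :* s)) refl k s (s ⁻¹))
      (by₂ (s ⁻¹) (- t) ts≡k² (⁻¹-inverseʳ s≢0) (solve 4 (λ k s t i →
        t :- i :* (k :* k :* con (+ 1) :+ con (+ 2) :* k :* con (+ 0) :* con (+ 0) :+ con (+ 0) :* con (+ 0) :* s) :=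
        i :* (t :* s :- k :* k) :+ :- t :* (s :* i :- con (+ 1))) refl k s t (s ⁻¹)))
    where
    s≢0 : s ≢ 0#
    s≢0 = nonsquare≢0 ¬sq

  -- K* is the disjoint union of its squares, which index the points k²s, and of their
  -- negatives, which index the points k²/s.
  linked : Fin q → Fin q → Fin q
  linked s k with KSquare? k
  ... | yes _ = k * s
  ... | no  _ = - k * s ⁻¹

  -- Write x = j² and -y = l² with j, l in K. Equality of the two values gives (js)² = l², so js =
  -- ±l, which is impossible for s outside K and j nonzero.
  linked-disjoint : ∀ {s x y} → ¬ IsSquare s → x ≢ 0# → KSquare x → y ∈K → y ≢ 0# → ¬ KSquare y → x * s ≢ - y * s ⁻¹
  linked-disjoint {s} {_} {y} ¬sq x≢0 (j , j∈ , refl) y∈ y≢0 ¬y-sq e with KSquare-± y∈ y≢0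
  ... | inj₁ y-sq = ¬y-sq y-sq
  ... | inj₂ (l , l∈ , l²≡-y) = *≢0ˡ x≢0 ([ vanish (closed-- _ l∈) ∘ move , vanish l∈ ∘ move′ ]′
      (square-injective {l} {j * s} (trans l²≡-y -y≡)))
    where
    -y≡ : - y ≡ j * s * (j * s)
    -y≡ = by₂ (- s) y e (⁻¹-inverseʳ (nonsquare≢0 ¬sq)) (solve 4 (λ s y j i →
      :- y :- j :* s :* (j :* s) := :- s :* (j :* j :* s :- :- y :* i) :+ y :* (s :* i :- con (+ 1))) refl s y j (s ⁻¹))
    vanish : ∀ {b} → b ∈K → j * s + b ≡ 0# → j ≡ 0#
    vanish b∈ = proj₁ ∘ independent (nonsquare∉K ¬sq) j∈ b∈
    move : j * s ≡ l → j * s + - l ≡ 0#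
    move refl = -‿inverseʳ _
    move′ : j * s ≡ - l → j * s + l ≡ 0#
    move′ js≡-l = trans (cong (_+ l) js≡-l) (solve 1 (λ l → :- l :+ l := con (+ 0)) refl l)

  linked-injective : ∀ {s} → ¬ IsSquare s → ∀ {x y} → x ∈ Kunits → y ∈ Kunits → linked s x ≡ linked s y → x ≡ y
  linked-injective {s} ¬sq {x} {y} x∈ y∈ e
    with KSquare? x | KSquare? y | ∈-Kunits⁻ x∈ | ∈-Kunits⁻ y∈
  ... | yes _    | yes _    | _          | _          = *-cancelʳ (nonsquare≢0 ¬sq) e
  ... | no  _    | no  _    | _          | _          = by₁ (- 1#) (*-cancelʳ (⁻¹≢0 (nonsquare≢0 ¬sq)) e)
        (solve 2 (λ x y → x :- y := :- con (+ 1) :* (:- x :- :- y)) refl x y)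
  ... | yes x-sq | no ¬y-sq | _ , x≢0    | y∈K , y≢0 = ⊥-elim (linked-disjoint ¬sq x≢0 x-sq y∈K y≢0 ¬y-sq e)
  ... | no ¬x-sq | yes y-sq | x∈K , x≢0 | _ , y≢0    = ⊥-elim (linked-disjoint ¬sq y≢0 y-sq x∈K x≢0 ¬x-sq (sym e))

  cls : Fin q → List (Fin q)
  cls s = map (linked s) Kunits

  Linked⇒∈-cls : ∀ {s t} → ¬ IsSquare s → Linked s t → t ∈ cls s
  Linked⇒∈-cls {s} ¬sq (k , k∈ , k≢0 , inj₁ refl) = subst (_∈ cls s) value
    (∈-map⁺ (linked s) (∈-Kunits⁺ (closed-* _ _ k∈ k∈) (*≢0 k≢0 k≢0)))
    where
    value : linked s (k * k) ≡ k * k * s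
    value with KSquare? (k * k)
    ... | yes _  = refl
    ... | no ¬k² = contradiction (k , k∈ , refl) ¬k²
  Linked⇒∈-cls {s} {t} ¬sq (k , k∈ , k≢0 , inj₂ ts≡k²) = subst (_∈ cls s) value
    (∈-map⁺ (linked s) (∈-Kunits⁺ (closed-- _ (closed-* _ _ k∈ k∈)) (-≢0 (*≢0 k≢0 k≢0))))
    where
    value : linked s (- (k * k)) ≡ t
    value with KSquare? (- (k * k))
    ... | yes sq = contradiction sq (-square-nonsquare k∈ k≢0)
    ... | no _   = by₂ (- s ⁻¹) t ts≡k² (⁻¹-inverseʳ (nonsquare≢0 ¬sq)) (solve 4 (λ k s t i →
      :- :- (k :* k) :* i :- t := :- i :* (t :* s :- k :* k) :+ t :* (s :* i :- con (+ 1))) refl k s t (s ⁻¹))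

  ∈-cls⇒Linked : ∀ {s t} → ¬ IsSquare s → t ∈ cls s → Linked s t
  ∈-cls⇒Linked {s} ¬sq t∈ with ∈-map⁻ (linked s) t∈
  ... | k , k∈ , refl with KSquare? k | ∈-Kunits⁻ k∈
  ...   | yes (j , j∈ , refl) | _ , k≢0 = j , j∈ , *≢0ˡ k≢0 , inj₁ refl
  ...   | no ¬k | k∈K , k≢0 with KSquare-± k∈K k≢0
  ...     | inj₁ sq = contradiction sq ¬k
  ...     | inj₂ (j , j∈ , j²≡-k) = j , j∈ , *≢0ˡ (subst (_≢ 0#) (sym j²≡-k) (-≢0 k≢0)) , inj₂
            (by₂ (- 1#) (- k) j²≡-k (⁻¹-inverseʳ (nonsquare≢0 ¬sq)) (solve 4 (λ k s j i →
              :- k :* i :* s :- j :* j := :- con (+ 1) :* (j :* j :- :- k) :+ :- k :* (s :* i :- con (+ 1))) refl k s j (s ⁻¹)))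

  ∈-cls⁺ : ∀ {s t} → ¬ IsSquare s → InOrbit (pt s) (pt t) → t ∈ cls s
  ∈-cls⁺ ¬sq = Linked⇒∈-cls ¬sq ∘ orbit⇒Linked ¬sq

  ∈-cls⁻ : ∀ {s t} → ¬ IsSquare s → t ∈ cls s → InOrbit (pt s) (pt t)
  ∈-cls⁻ ¬sq = Linked⇒orbit ¬sq ∘ ∈-cls⇒Linked ¬sq

  cls-nonsquare : ∀ {s t} → ¬ IsSquare s → t ∈ cls s → ¬ IsSquare t
  cls-nonsquare ¬sq t∈ = pt-Internal⁻ (orbit-Internal (pt-Internal⁺ ¬sq) (∈-cls⁻ ¬sq t∈))

  -- Reflexivity, symmetry and transitivity are inherited from the orbit relation. The explicit list
  -- is used only for the size r - 1 and the absence of repetitions.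
  partitioned : Partitioned cls (2 ℕ.+ 4 ℕ.* k) nonsquares
  partitioned = record
    { unique     = nonsquares-unique
    ; cls-unique = λ s∈ → map-unique (linked-injective (∈-nonsquares⁻ s∈)) Kunits-unique
    ; cls-length = λ {s} _ → trans (length-map (linked s) Kunits) ∣Kunits∣
    ; cls-⊆      = λ s∈ t∈ → ∈-nonsquares⁺ (cls-nonsquare (∈-nonsquares⁻ s∈) t∈)
    ; cls-refl   = λ {s} s∈ → ∈-cls⁺ (∈-nonsquares⁻ s∈) (orbit-refl (pt s))
    ; cls-sym    = λ s∈ t∈ → let ¬sq = ∈-nonsquares⁻ s∈ in
        ∈-cls⁺ (cls-nonsquare ¬sq t∈) (orbit-sym (∈-cls⁻ ¬sq t∈))
    ; cls-trans  = λ s∈ t∈ u∈ → let ¬sq = ∈-nonsquares⁻ s∈ in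
        ∈-cls⁺ ¬sq (orbit-trans (∈-cls⁻ ¬sq t∈) (∈-cls⁻ (cls-nonsquare ¬sq t∈) u∈))
    }

  -- Every good orbit contains a point (1, 0, s).

  GoodOrbit-orbit : ∀ {P X} → GoodOrbit P → InOrbit P X → GoodOrbit X
  GoodOrbit-orbit (int , perp) PX =
    (λ Y XY → int Y (orbit-trans PX XY)) , (λ Y Z XY XZ → perp Y Z (orbit-trans PX XY) (orbit-trans PX XZ))

  -- Expresses that P is an internal point on a K-rational secant: the points (1, 0, s) lie on X₂ =
  -- 0, which meets the conic in (1, 0, 0) and (0, 0, 1).
  Hyperbolic : Vec3 → Set
  Hyperbolic P = ∃ λ s → ¬ IsSquare s × InOrbit P (pt s)

  Hyperbolic-orbit : ∀ {P X} → InOrbit P X → Hyperbolic X → Hyperbolic P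
  Hyperbolic-orbit PX (s , ¬sq , Xs) = s , ¬sq , orbit-trans PX Xs

  middle≡0⇒Hyperbolic : ∀ {x y z} → Internal (x , y , z) → y ≡ 0# → Hyperbolic (x , y , z)
  middle≡0⇒Hyperbolic {x} {_} {z} int@(Q≢0 , _) refl = x ⁻¹ * z , pt-Internal⁻ (orbit-Internal int orbit) , orbit
    where
    x≢0 : x ≢ 0#
    x≢0 refl = Q≢0 (solve 1 (λ z → con (+ 0) :* con (+ 0) :- con (+ 0) :* z := con (+ 0)) refl z)
    orbit : InOrbit (x , 0# , z) (pt (x ⁻¹ * z))
    orbit = subst (InOrbit _) (triple-≡ (trans (*-comm (x ⁻¹) x) (⁻¹-inverseʳ x≢0)) (zeroʳ (x ⁻¹)) refl)
      (orbit-scale (x , 0# , z) (⁻¹≢0 x≢0))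

  -- The line X₃ = nX₁ meets the conic in (1, ±m, n) when n = m²; these two points are
  -- sent to (1, 0, 0) and (0, 0, 1). When n = -m², a quarter turn about the pole of the
  -- line maps (1, x, n) to a conjugate point.
  normal⇒Hyperbolic : ∀ {x n} → n ∈K → GoodOrbit (1# , x , n) → Hyperbolic (1# , x , n)
  normal⇒Hyperbolic {x} {n} n∈ (int , perp) = [ secant , ⊥-elim ∘ external ]′ (KSquare-± n∈ n≢0)
    where
    P : Vec3
    P = 1# , x , n
    n≢0 : n ≢ 0#
    n≢0 refl = proj₂ (int P (orbit-refl P)) (x , solve 1 (λ x → x :* x := x :* x :- con (+ 1) :* con (+ 0)) refl x)
    secant : KSquare n → Hyperbolic P
    secant (m , m∈ , refl) = Hyperbolic-orbit orbit (middle≡0⇒Hyperbolic (int _ orbit)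
      (solve 2 (λ m x → m :* :- m :* con (+ 1) :+ (m :* con (+ 1) :+ :- m :* con (+ 1)) :* x :+ con (+ 1) :* con (+ 1) :* (m :* m) := con (+ 0)) refl m x))
      where
      orbit : InOrbit P (actG m (- m) 1# 1# P)
      orbit = orbit-actG m (- m) 1# 1# P m∈ (closed-- _ m∈) has-1 has-1
        (subst (_≢ 0#) (solve 1 (λ m → con (+ 2) :* m := m :* con (+ 1) :- :- m :* con (+ 1)) refl m) (*≢0 2≢0 (*≢0ˡ n≢0)))
    external : KSquare (- n) → ⊥
    -- The two-by-two matrix is m + J, where J sends (t, u) to (-u, m²t) and J² = -m². Its
    -- eigenvalues are m(1 ± i), with ratio a square root of -1, and its fixed points on the conic
    -- are the two on the line X₃ = nX₁.
    external (m , m∈ , m²≡-n) = perp P (actG m (m * m) (- 1#) m P) (orbit-refl P)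
      (orbit-actG m (m * m) (- 1#) m P m∈ (closed-* _ _ m∈ m∈) (closed-- _ has-1) m∈
        (subst (_≢ 0#) (solve 1 (λ m → con (+ 2) :* (m :* m) := m :* m :- m :* m :* :- con (+ 1)) refl m)
          (*≢0 2≢0 (subst (_≢ 0#) (sym m²≡-n) (-≢0 n≢0)))))
      (by₁ (m * m + n) m²≡-n (solve 3 (λ m n x →
        n :* (m :* m :* con (+ 1) :+ con (+ 2) :* m :* :- con (+ 1) :* x :+ :- con (+ 1) :* :- con (+ 1) :* n)
        :- con (+ 2) :* x :* (m :* (m :* m) :* con (+ 1) :+ (m :* m :+ m :* m :* :- con (+ 1)) :* x :+ :- con (+ 1) :* m :* n)
        :+ con (+ 1) :* (m :* m :* (m :* m) :* con (+ 1) :+ con (+ 2) :* (m :* m) :* m :* x :+ m :* m :* n) :- con (+ 0) :=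
        (m :* m :+ n) :* (m :* m :- :- n)) refl m n x))

  -- Finds the K-rational line through the normalised point (1, y, z). If y is in K it is X₂ = yX₁,
  -- which a translation moves to X₂ = 0. Otherwise 1 and y span F over K, z = a + by gives the line
  -- X₃ = aX₁ + bX₂, and translation by -b/2 completes the square, leaving X₃ = nX₁.
  good⇒Hyperbolic : ∀ {P} → GoodOrbit P → Hyperbolic P
  good⇒Hyperbolic {P@(x , y , z)} good@(int , _) =
    Hyperbolic-orbit (orbit-scale P (⁻¹≢0 x≢0)) (subst Hyperbolic (sym affine≡)
      (affine (subst GoodOrbit affine≡ (GoodOrbit-orbit good (orbit-scale P (⁻¹≢0 x≢0))))))
    where
    x≢0 : x ≢ 0#
    x≢0 refl = proj₂ (int P (orbit-refl P)) (y , solve 2 (λ y z → y :* y := y :* y :- con (+ 0) :* z) refl y z)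
    affine≡ : scale (x ⁻¹) P ≡ (1# , x ⁻¹ * y , x ⁻¹ * z)
    affine≡ = triple-≡ (trans (*-comm (x ⁻¹) x) (⁻¹-inverseʳ x≢0)) refl refl
    affine : ∀ {y z} → GoodOrbit (1# , y , z) → Hyperbolic (1# , y , z)
    affine {y} {z} good with y ∈K?
    ... | yes y∈ = Hyperbolic-orbit orbit (middle≡0⇒Hyperbolic (proj₁ good _ orbit)
          (solve 2 (λ y z → con (+ 1) :* :- y :* con (+ 1) :+ (con (+ 1) :* con (+ 1) :+ :- y :* con (+ 0)) :* y :+ con (+ 0) :* con (+ 1) :* z := con (+ 0)) refl y z))
      where
      orbit : InOrbit (1# , y , z) (actG 1# (- y) 0# 1# (1# , y , z))
      orbit = orbit-actG 1# (- y) 0# 1# (1# , y , z) has-1 (closed-- _ y∈) has-0 has-1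
        (subst (_≢ 0#) (solve 1 (λ y → con (+ 1) := con (+ 1) :* con (+ 1) :- :- y :* con (+ 0)) refl y) 1≢0)
    ... | no y∉ with basis y∉ z
    ...   | a , b , a∈ , b∈ , z≡a+by = Hyperbolic-orbit orbit (normal⇒Hyperbolic n∈ (GoodOrbit-orbit good orbit))
      where
      h n : Fin q
      h = half b
      n = a + h * h
      n∈ : n ∈K
      n∈ = closed-+ _ _ a∈ (closed-* _ _ (half-∈K b∈) (half-∈K b∈))
      orbit : InOrbit (1# , y , z) (1# , y - h , n)
      orbit = subst (InOrbit _) (triple-≡
          (solve 2 (λ y z → con (+ 1) :* con (+ 1) :* con (+ 1) :+ con (+ 2) :* con (+ 1) :* con (+ 0) :* y :+ con (+ 0) :* con (+ 0) :* z := con (+ 1)) refl y z)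
          (solve 3 (λ y z h → con (+ 1) :* :- h :* con (+ 1) :+ (con (+ 1) :* con (+ 1) :+ :- h :* con (+ 0)) :* y :+ con (+ 0) :* con (+ 1) :* z := y :- h) refl y z h)
          (by₂ 1# (- y) z≡a+by (half+half b)
            (solve 5 (λ y z a b h → :- h :* :- h :* con (+ 1) :+ con (+ 2) :* :- h :* con (+ 1) :* y :+ con (+ 1) :* con (+ 1) :* z :- (a :+ h :* h) :=
              con (+ 1) :* (z :- (a :+ b :* y)) :+ :- y :* (h :+ h :- b)) refl y z a b h)))
        (orbit-actG 1# (- h) 0# 1# (1# , y , z) has-1 (closed-- _ (half-∈K b∈)) has-0 has-1
          (subst (_≢ 0#) (solve 1 (λ h → con (+ 1) := con (+ 1) :* con (+ 1) :- :- h :* con (+ 0)) refl h) 1≢0))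

  -- Counting the orbits.

  open Transversal (transversal partitioned) renaming (size to ∣reps∣)

  numGoodOrbits : NumGoodOrbits≡ (2 ℕ.+ 2 ℕ.* k)
  numGoodOrbits = map pt reps , trans (length-map pt reps) count , All.map⁺ (All.map good reps-⊆) ,
    AllPairs.map⁺ (distinct reps-⊆ separate) , covered
    where
    arith : ∀ k n → suc (n ℕ.* (2 ℕ.+ 4 ℕ.* k) ℕ.* 2) ≡ suc (n ℕ.* (4 ℕ.+ 8 ℕ.* k))
    arith = solve-∀
    arith′ : ∀ k → (3 ℕ.+ 4 ℕ.* k) ℕ.* (3 ℕ.+ 4 ℕ.* k) ≡ suc ((2 ℕ.+ 2 ℕ.* k) ℕ.* (4 ℕ.+ 8 ℕ.* k))
    arith′ = solve-∀
    -- The constant 4 + 8k is 2(r - 1): doubling the number of nonsquares gives r² - 1 = length reps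
    -- * 2(r - 1), and the common factor is cancelled.
    count : length reps ≡ 2 ℕ.+ 2 ℕ.* k
    count = ℕ.*-cancelʳ-≡ _ _ (4 ℕ.+ 8 ℕ.* k) (ℕ.suc-injective (begin
      suc (length reps ℕ.* (4 ℕ.+ 8 ℕ.* k))           ≡⟨ arith k (length reps) ⟨
      suc (length reps ℕ.* (2 ℕ.+ 4 ℕ.* k) ℕ.* 2)     ≡⟨ cong (λ n → suc (n ℕ.* 2)) ∣reps∣ ⟩
      suc (length nonsquares ℕ.* 2)                   ≡⟨ ∣nonsquares∣ 2≢0 ⟩
      q                                               ≡⟨ q≡r² ⟩
      r ℕ.* r                                         ≡⟨ cong (λ r → r ℕ.* r) r≡3+4k ⟩
      (3 ℕ.+ 4 ℕ.* k) ℕ.* (3 ℕ.+ 4 ℕ.* k)             ≡⟨ arith′ k ⟩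
      suc ((2 ℕ.+ 2 ℕ.* k) ℕ.* (4 ℕ.+ 8 ℕ.* k))       ∎))
      where open ≡-Reasoning
    good : ∀ {s} → s ∈ nonsquares → NonZero3 (pt s) × GoodOrbit (pt s)
    good s∈ = (λ e → 1≢0 (cong proj₁ e)) , pt-GoodOrbit (∈-nonsquares⁻ s∈)
    distinct : ∀ {xs} → All (_∈ nonsquares) xs → AllPairs (λ x y → y ∉ cls x) xs →
      AllPairs (λ x y → ¬ InOrbit (pt x) (pt y)) xs
    distinct []        []       = []
    distinct (x∈ ∷ xs) (p ∷ ps) = All.map (_∘ ∈-cls⁺ (∈-nonsquares⁻ x∈)) p ∷ distinct xs ps
    covered : ∀ P → NonZero3 P → GoodOrbit P → Any (λ R → InOrbit R P) (map pt reps)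
    covered P _ goodP = let (s , ¬sq , Ps) = good⇒Hyperbolic goodP in
      Any.map⁺ (transport Ps reps-⊆ (cover (∈-nonsquares⁺ ¬sq)))
      where
      transport : ∀ {s xs} → InOrbit P (pt s) → All (_∈ nonsquares) xs →
        Any (λ x → s ∈ cls x) xs → Any (λ x → InOrbit (pt x) P) xs
      transport Ps (x∈ ∷ _)  (here s∈) = here (orbit-trans (∈-cls⁻ (∈-nonsquares⁻ x∈) s∈) (orbit-sym Ps))
      transport Ps (_ ∷ xs∈) (there a) = there (transport Ps xs∈ a)

-- Specialisation to r = p^h.

open import Data.Nat using (ℕ; _≤_; _*_; _+_; _^_; _%_; _/_)

theorem2p7 : (p h : ℕ) → Prime p → p % 2 ≡ 1 → 1 ≤ h → (p ^ h) % 4 ≡ 3 →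
    (F : FiniteField (p ^ (2 * h))) → (K : Subfield F (p ^ h)) →
    Plane.WithSubfield.NumGoodOrbits≡ F K ((p ^ h + 1) / 2)
theorem2p7 p h _ _ _ r%4≡3 F K = subst (Plane.WithSubfield.NumGoodOrbits≡ F K) (sym number)
  (Orbits.numGoodOrbits F K k r≡3+4k q≡r²)
  where
  k : ℕ
  k = p ^ h / 4
  r≡3+4k : p ^ h ≡ 3 + 4 * k
  r≡3+4k = trans (m≡m%n+[m/n]*n (p ^ h) 4) (cong₂ _+_ r%4≡3 (ℕ.*-comm k 4))
  q≡r² : p ^ (2 * h) ≡ p ^ h * p ^ h
  q≡r² = trans (ℕ.^-distribˡ-+-* p h (h + 0)) (cong (λ n → p ^ h * p ^ n) (ℕ.+-identityʳ h))
  double : ∀ k → 3 + 4 * k + 1 ≡ (2 + 2 * k) * 2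
  double = solve-∀
  number : (p ^ h + 1) / 2 ≡ 2 + 2 * k
  number = trans (cong (λ r → (r + 1) / 2) r≡3+4k) (trans (cong (_/ 2) (double k)) (m*n/n≡m (2 + 2 * k) 2))
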